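{- Let $D_n=\sum_{k=0}^n\binom{n}{k}^2\binom{2k}{k}\binom{2(n-k)}{n-k}$ for $n\ge 0$ be the Domb numbers. Let $\{B_n\}_{n\ge 0}\subset\mathbb{Q}$ be the sequence defined by $B_0=0$, $B_1=1$ and the recurrence \[ (n+1)^3B_{n+1}=2(2n+1)(5n^2+5n+2)B_n-64n^3B_{n-1}\qquad(n\ge 1). \] Then \[ \lim_{n\to\infty}\frac{B_n}{D_n}=\frac{7}{24}\zeta(3). \]
   Context: $\zeta$ denotes the Riemann zeta function. -}

module Defs where

open import Data.Nat as ℕ using (ℕ; zero; suc; z≤n; s≤s; NonZero; NonTrivial)
import Data.Nat.Properties as ℕ
open import Data.Nat.Combinatorics using (_C_; nCn≡1; nCk≡nC[n∸k]; nCk+nC[k+1]≡[n+1]C[k+1])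
open import Data.Nat.Tactic.RingSolver using (solve-∀)
open import Data.Integer as ℤ using (+_; +[1+_]; -[1+_]; +<+)
import Data.Integer.Properties as ℤ
open import Data.List using (map; upTo)
open import Data.Nat.ListAction using (sum)
open import Data.Product using (∃-syntax; _×_; _,_)
open import Data.Rational as ℚ
  using (ℚ; mkℚ; 0ℚ; 1ℚ; ½; _/_; _+_; _-_; _*_; -_; ∣_∣; _≤_; _<_; 1/_; *<*)
import Data.Rational.Properties as ℚ
open import Data.Rational.Solver using (module +-*-Solver)
open import Data.Rational.Unnormalised as ℚᵘ using (mkℚᵘ; *≤*; *≡*)
import Data.Rational.Unnormalised.Properties as ℚᵘ
open import Data.Sum using (inj₁; inj₂)
open import Relation.Binary.PropositionalEquality using (_≡_; refl; sym; trans; cong; cong₂; subst; subst₂)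

-- Different Cauchy sequences may denote the same real; _<ℝ_ and _⟶_ below do not
-- depend on the choice of representatives.
record ℝ : Set where
  constructor mkℝ
  field
    seq    : ℕ → ℚ
    cauchy : ∀ ε → 0ℚ < ε →
             ∃[ N ] (∀ m n → N ℕ.≤ m → N ℕ.≤ n → ∣ seq m - seq n ∣ < ε)

open ℝ public

private
  open +-*-Solver

  ∣∣-≤ : ∀ {p q} → p ≤ q → - p ≤ q → ∣ p ∣ ≤ q
  ∣∣-≤ {p} {q} a b with ℚ.∣p∣≡p∨∣p∣≡-p p
  ... | inj₁ e = subst (_≤ q) (sym e) a
  ... | inj₂ e = subst (_≤ q) (sym e) b

  neg-sub : ∀ p q → - (p - q) ≡ q - p
  neg-sub = solve 2 (λ p q → :- (p :- q) := q :- p) refl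

  half+half : ∀ ε → ½ * ε + ½ * ε ≡ ε
  half+half = solve 1 (λ e → con ½ :* e :+ con ½ :* e := e) refl

  half>0 : ∀ {ε} → 0ℚ < ε → 0ℚ < ½ * ε
  half>0 {ε} h = ℚ.*-monoʳ-<-pos ½ h

  ∣∣-sub-swap : ∀ p q → ∣ p - q ∣ ≡ ∣ q - p ∣
  ∣∣-sub-swap p q = trans (sym (ℚ.∣-p∣≡∣p∣ (p - q))) (cong ∣_∣ (neg-sub p q))

  rev-tri : ∀ p q → ∣ p ∣ - ∣ q ∣ ≤ ∣ p - q ∣
  rev-tri p q = begin
    ∣ p ∣ - ∣ q ∣
      ≡⟨ cong (λ z → ∣ z ∣ - ∣ q ∣) (solve 2 (λ p q → p := (p :- q) :+ q) refl p q) ⟩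
    ∣ (p - q) + q ∣ - ∣ q ∣
      ≤⟨ ℚ.+-monoˡ-≤ (- ∣ q ∣) (ℚ.∣p+q∣≤∣p∣+∣q∣ (p - q) q) ⟩
    (∣ p - q ∣ + ∣ q ∣) - ∣ q ∣
      ≡⟨ solve 2 (λ a b → (a :+ b) :- b := a) refl ∣ p - q ∣ ∣ q ∣ ⟩
    ∣ p - q ∣ ∎
    where open ℚ.≤-Reasoning

fromℚ : ℚ → ℝ
fromℚ q = mkℝ (λ _ → q) λ ε ε>0 →
  0 , λ _ _ _ _ → subst (_< ε) (cong ∣_∣ (sym (ℚ.+-inverseʳ q))) ε>0

infixl 6 _-ℝ_
infixl 7 _*ℝ_

_-ℝ_ : ℝ → ℝ → ℝ
x -ℝ y = mkℝ (λ n → seq x n - seq y n) prf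
  where
  prf : ∀ ε → 0ℚ < ε → ∃[ N ] (∀ m n → N ℕ.≤ m → N ℕ.≤ n →
        ∣ (seq x m - seq y m) - (seq x n - seq y n) ∣ < ε)
  prf ε ε>0 with cauchy x (½ * ε) (half>0 ε>0) | cauchy y (½ * ε) (half>0 ε>0)
  ... | N₁ , h₁ | N₂ , h₂ = N₁ ℕ.⊔ N₂ , λ m n m≥ n≥ → begin-strict
    ∣ (seq x m - seq y m) - (seq x n - seq y n) ∣
      ≡⟨ cong ∣_∣ (solve 4 (λ a b c d → (a :- b) :- (c :- d) := (a :- c) :- (b :- d)) refl
           (seq x m) (seq y m) (seq x n) (seq y n)) ⟩
    ∣ (seq x m - seq x n) - (seq y m - seq y n) ∣
      ≤⟨ ℚ.∣p-q∣≤∣p∣+∣q∣ (seq x m - seq x n) (seq y m - seq y n) ⟩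
    ∣ seq x m - seq x n ∣ + ∣ seq y m - seq y n ∣
      <⟨ ℚ.+-mono-< (h₁ m n (ℕ.m⊔n≤o⇒m≤o N₁ N₂ m≥) (ℕ.m⊔n≤o⇒m≤o N₁ N₂ n≥))
                    (h₂ m n (ℕ.m⊔n≤o⇒n≤o N₁ N₂ m≥) (ℕ.m⊔n≤o⇒n≤o N₁ N₂ n≥)) ⟩
    ½ * ε + ½ * ε
      ≡⟨ half+half ε ⟩
    ε ∎
    where open ℚ.≤-Reasoning

∣_∣ℝ : ℝ → ℝ
∣ x ∣ℝ = mkℝ (λ n → ∣ seq x n ∣) prf
  where
  le : ∀ p q → ∣ ∣ p ∣ - ∣ q ∣ ∣ ≤ ∣ p - q ∣
  le p q = ∣∣-≤ (rev-tri p q)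
    (subst₂ _≤_ (sym (neg-sub ∣ p ∣ ∣ q ∣)) (∣∣-sub-swap q p) (rev-tri q p))

  prf : ∀ ε → 0ℚ < ε → ∃[ N ] (∀ m n → N ℕ.≤ m → N ℕ.≤ n →
        ∣ ∣ seq x m ∣ - ∣ seq x n ∣ ∣ < ε)
  prf ε ε>0 with cauchy x ε ε>0
  ... | N , h = N , λ m n m≥ n≥ → ℚ.≤-<-trans (le (seq x m) (seq x n)) (h m n m≥ n≥)

private
  eventually-bounded : ∀ x → ∃[ M ] (0ℚ < M × ∃[ N ] (∀ n → N ℕ.≤ n → ∣ seq x n ∣ ≤ M))
  eventually-bounded x with cauchy x 1ℚ (*<* (+<+ (s≤s z≤n)))
  ... | N , h = ∣ seq x N ∣ + 1ℚ
              , ℚ.+-mono-≤-< {0ℚ} {∣ seq x N ∣} {0ℚ} {1ℚ} (ℚ.0≤∣p∣ (seq x N)) (*<* (+<+ (s≤s z≤n)))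
              , N , λ n n≥ → begin
    ∣ seq x n ∣
      ≡⟨ solve 2 (λ a b → a := b :+ (a :- b)) refl ∣ seq x n ∣ ∣ seq x N ∣ ⟩
    ∣ seq x N ∣ + (∣ seq x n ∣ - ∣ seq x N ∣)
      ≤⟨ ℚ.+-monoʳ-≤ ∣ seq x N ∣ (ℚ.≤-trans (rev-tri (seq x n) (seq x N)) (ℚ.<⇒≤ (h n N n≥ ℕ.≤-refl))) ⟩
    ∣ seq x N ∣ + 1ℚ ∎
    where open ℚ.≤-Reasoning

  scaled : ∀ {M ε} → 0ℚ < M → 0ℚ < ε → ∃[ δ ] (0ℚ < δ × M * δ ≡ ½ * ε)
  scaled {M} {ε} M>0 ε>0 = (1/ M) * (½ * ε) , pos , eq
    where
    instance
      M⁺ = ℚ.positive M>0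
      M≢0 = ℚ.pos⇒nonZero M
      M⁻¹⁺ = ℚ.1/pos⇒pos M
    pos : 0ℚ < (1/ M) * (½ * ε)
    pos = subst (_< (1/ M) * (½ * ε)) (ℚ.*-zeroʳ (1/ M)) (ℚ.*-monoʳ-<-pos (1/ M) (half>0 ε>0))
    eq : M * ((1/ M) * (½ * ε)) ≡ ½ * ε
    eq = trans (sym (ℚ.*-assoc M (1/ M) (½ * ε)))
          (trans (cong (_* (½ * ε)) (ℚ.*-inverseʳ M)) (ℚ.*-identityˡ (½ * ε)))

  product-diff : ∀ a b c d → a * b - c * d ≡ a * (b - d) + d * (a - c)
  product-diff = solve 4 (λ a b c d → a :* b :- c :* d := a :* (b :- d) :+ d :* (a :- c)) refl

  ∣*∣-bound : ∀ p q {M δ} → ∣ p ∣ ≤ M → ∣ q ∣ < δ → 0ℚ < M → ∣ p * q ∣ < M * δ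
  ∣*∣-bound p q {M} {δ} p≤ q< M>0 = begin-strict
    ∣ p * q ∣       ≡⟨ ℚ.∣p*q∣≡∣p∣*∣q∣ p q ⟩
    ∣ p ∣ * ∣ q ∣   ≤⟨ ℚ.*-monoʳ-≤-nonNeg ∣ q ∣ {{ℚ.∣-∣-nonNeg q}} p≤ ⟩
    M * ∣ q ∣       <⟨ ℚ.*-monoʳ-<-pos M {{ℚ.positive M>0}} q< ⟩
    M * δ           ∎
    where open ℚ.≤-Reasoning

  product-close : ∀ a b c d {A B α β} → 0ℚ < A → 0ℚ < B → ∣ a ∣ ≤ A → ∣ d ∣ ≤ B →
    ∣ b - d ∣ < α → ∣ a - c ∣ < β → ∣ a * b - c * d ∣ < A * α + B * β
  product-close a b c d {A} {B} {α} {β} A>0 B>0 a≤ d≤ bd ac = begin-strict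
    ∣ a * b - c * d ∣
      ≡⟨ cong ∣_∣ (product-diff a b c d) ⟩
    ∣ a * (b - d) + d * (a - c) ∣
      ≤⟨ ℚ.∣p+q∣≤∣p∣+∣q∣ (a * (b - d)) (d * (a - c)) ⟩
    ∣ a * (b - d) ∣ + ∣ d * (a - c) ∣
      <⟨ ℚ.+-mono-< {∣ a * (b - d) ∣} {A * α} {∣ d * (a - c) ∣} {B * β}
           (∣*∣-bound a (b - d) a≤ bd A>0) (∣*∣-bound d (a - c) d≤ ac B>0) ⟩
    A * α + B * β ∎
    where open ℚ.≤-Reasoning

_*ℝ_ : ℝ → ℝ → ℝ
x *ℝ y = mkℝ (λ n → seq x n * seq y n) prf
  where
  prf : ∀ ε → 0ℚ < ε → ∃[ N ] (∀ m n → N ℕ.≤ m → N ℕ.≤ n →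
        ∣ seq x m * seq y m - seq x n * seq y n ∣ < ε)
  prf ε ε>0 =
    let A , A>0 , N₁ , hA = eventually-bounded x
        B , B>0 , N₂ , hB = eventually-bounded y
        α , α>0 , Aα = scaled A>0 ε>0
        β , β>0 , Bβ = scaled B>0 ε>0
        N₃ , h₃ = cauchy y α α>0
        N₄ , h₄ = cauchy x β β>0
        N₁₂ = N₁ ℕ.⊔ N₂
        N₃₄ = N₃ ℕ.⊔ N₄
    in N₁₂ ℕ.⊔ N₃₄ , λ m n m≥ n≥ →
    let m₁₂ = ℕ.m⊔n≤o⇒m≤o N₁₂ N₃₄ m≥
        m₃₄ = ℕ.m⊔n≤o⇒n≤o N₁₂ N₃₄ m≥
        n₁₂ = ℕ.m⊔n≤o⇒m≤o N₁₂ N₃₄ n≥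
        n₃₄ = ℕ.m⊔n≤o⇒n≤o N₁₂ N₃₄ n≥
    in subst (∣ seq x m * seq y m - seq x n * seq y n ∣ <_)
         (trans (cong₂ _+_ Aα Bβ) (half+half ε))
         (product-close (seq x m) (seq y m) (seq x n) (seq y n) A>0 B>0
           (hA m (ℕ.m⊔n≤o⇒m≤o N₁ N₂ m₁₂))
           (hB n (ℕ.m⊔n≤o⇒n≤o N₁ N₂ n₁₂))
           (h₃ m n (ℕ.m⊔n≤o⇒m≤o N₃ N₄ m₃₄) (ℕ.m⊔n≤o⇒m≤o N₃ N₄ n₃₄))
           (h₄ m n (ℕ.m⊔n≤o⇒n≤o N₃ N₄ m₃₄) (ℕ.m⊔n≤o⇒n≤o N₃ N₄ n₃₄)))

infix 4 _<ℝ_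

-- The gap δ makes this the order of the limits: a termwise inequality alone
-- would allow equal reals.
_<ℝ_ : ℝ → ℝ → Set
x <ℝ y = ∃[ δ ] (0ℚ < δ × ∃[ N ] (∀ n → N ℕ.≤ n → seq x n + δ < seq y n))

infix 4 _⟶_

_⟶_ : (ℕ → ℝ) → ℝ → Set
a ⟶ L = ∀ ε → fromℚ 0ℚ <ℝ ε → ∃[ N ] (∀ n → N ℕ.≤ n → ∣ a n -ℝ L ∣ℝ <ℝ ε)

zetaPartial : (s : ℕ) → ℕ → ℚ
zetaPartial s zero    = 0ℚ
zetaPartial s (suc n) = zetaPartial s n + (+ 1 / (suc n ℕ.^ s)) {{ℕ.m^n≢0 (suc n) s}}

private
  frac≤ : ∀ a b c d .{{_ : NonZero b}} .{{_ : NonZero d}} →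
          a ℕ.* d ℕ.≤ c ℕ.* b → + a / b ≤ + c / d
  frac≤ a (suc b) c (suc d) h = ℚ.toℚᵘ-cancel-≤ (ℚᵘ.≤-trans
    (ℚᵘ.≤-reflexive (ℚ.toℚᵘ-fromℚᵘ (mkℚᵘ (+ a) b)))
    (ℚᵘ.≤-trans (*≤* (subst₂ ℤ._≤_ (ℤ.pos-* a (suc d)) (ℤ.pos-* c (suc b)) (ℤ.+≤+ h)))
      (ℚᵘ.≤-reflexive (ℚᵘ.≃-sym (ℚ.toℚᵘ-fromℚᵘ (mkℚᵘ (+ c) d))))))

  frac+ : ∀ a b c d .{{_ : NonZero b}} .{{_ : NonZero d}} .{{_ : NonZero (b ℕ.* d)}} →
          + a / b + + c / d ≡ + (a ℕ.* d ℕ.+ c ℕ.* b) / (b ℕ.* d)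
  frac+ a (suc b) c (suc d) = ℚ.toℚᵘ-injective (ℚᵘ.≃-trans
    (ℚ.toℚᵘ-homo-+ (+ a / suc b) (+ c / suc d))
    (ℚᵘ.≃-trans
      (ℚᵘ.+-cong (ℚ.toℚᵘ-fromℚᵘ (mkℚᵘ (+ a) b)) (ℚ.toℚᵘ-fromℚᵘ (mkℚᵘ (+ c) d)))
      (ℚᵘ.≃-trans
        (ℚᵘ.≃-reflexive (cong (λ z → mkℚᵘ z (d ℕ.+ b ℕ.* suc d))
          (cong₂ ℤ._+_ (sym (ℤ.pos-* a (suc d))) (sym (ℤ.pos-* c (suc b))))))
        (ℚᵘ.≃-sym (ℚ.toℚᵘ-fromℚᵘ (mkℚᵘ (+ (a ℕ.* suc d ℕ.+ c ℕ.* suc b)) (d ℕ.+ b ℕ.* suc d)))))))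

  cross : ∀ n → (1 ℕ.* suc (suc n) ℕ.+ 1 ℕ.* (suc n ℕ.* suc (suc n))) ℕ.* suc n
                ≡ 1 ℕ.* (suc n ℕ.* suc (suc n) ℕ.* suc (suc n))
  cross = solve-∀

  -- 1/(m+1)ˢ ≤ 1/m - 1/(m+1), with m = suc n
  telescope : ∀ s .{{_ : NonTrivial s}} n →
    (+ 1 / (suc (suc n) ℕ.^ s)) {{ℕ.m^n≢0 (suc (suc n)) s}} + (+ 1 / suc (suc n)) ≤ + 1 / suc n
  telescope s n = begin
    (+ 1 / (k ℕ.^ s)) {{ks}} + (+ 1 / k)
      ≤⟨ ℚ.+-monoˡ-≤ (+ 1 / k) (frac≤ 1 (k ℕ.^ s) 1 (suc n ℕ.* k) {{ks}} step) ⟩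
    (+ 1 / (suc n ℕ.* k)) + (+ 1 / k)
      ≡⟨ frac+ 1 (suc n ℕ.* k) 1 k ⟩
    + (1 ℕ.* k ℕ.+ 1 ℕ.* (suc n ℕ.* k)) / (suc n ℕ.* k ℕ.* k)
      ≤⟨ frac≤ (1 ℕ.* k ℕ.+ 1 ℕ.* (suc n ℕ.* k)) (suc n ℕ.* k ℕ.* k) 1 (suc n) (ℕ.≤-reflexive
           (cross n)) ⟩
    + 1 / suc n ∎
    where
    open ℚ.≤-Reasoning
    k = suc (suc n)
    ks = ℕ.m^n≢0 k s
    step : 1 ℕ.* (suc n ℕ.* k) ℕ.≤ 1 ℕ.* (k ℕ.^ s)
    step = ℕ.*-monoʳ-≤ 1 (ℕ.≤-trans
      (ℕ.*-mono-≤ (ℕ.n≤1+n (suc n)) (ℕ.≤-reflexive (sym (ℕ.*-identityʳ k))))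
      (ℕ.^-monoʳ-≤ k (ℕ.nonTrivial⇒n>1 s)))

  zetaPartial-mono : ∀ s {m n} → m ℕ.≤′ n → zetaPartial s m ≤ zetaPartial s n
  zetaPartial-mono s ℕ.≤′-refl = ℚ.≤-refl
  zetaPartial-mono s {m} {suc n} (ℕ.≤′-step h) = ℚ.≤-trans (zetaPartial-mono s h)
    (subst (_≤ zetaPartial s (suc n)) (ℚ.+-identityʳ (zetaPartial s n))
      (ℚ.+-monoʳ-≤ (zetaPartial s n)
        (frac≤ 0 1 1 (suc n ℕ.^ s) {{_}} {{ℕ.m^n≢0 (suc n) s}} z≤n)))

  zetaPartial-anti : ∀ s .{{_ : NonTrivial s}} {m n} → m ℕ.≤′ n →
    zetaPartial s (suc n) + + 1 / suc n ≤ zetaPartial s (suc m) + + 1 / suc m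
  zetaPartial-anti s ℕ.≤′-refl = ℚ.≤-refl
  zetaPartial-anti s {m} {suc n} (ℕ.≤′-step h) = ℚ.≤-trans
    (subst (_≤ zetaPartial s (suc n) + + 1 / suc n)
      (sym (ℚ.+-assoc (zetaPartial s (suc n))
        ((+ 1 / (suc (suc n) ℕ.^ s)) {{ℕ.m^n≢0 (suc (suc n)) s}}) (+ 1 / suc (suc n))))
      (ℚ.+-monoʳ-≤ (zetaPartial s (suc n)) (telescope s n)))
    (zetaPartial-anti s h)

  -- With S = zetaPartial s: S(N) ≤ S(n) and S(m) + 1/m ≤ S(N) + 1/N for 1 ≤ N ≤ m, n.
  zetaPartial-tail : ∀ s .{{_ : NonTrivial s}} N {m n} → suc N ℕ.≤ m → suc N ℕ.≤ n →
    zetaPartial s m - zetaPartial s n ≤ + 1 / suc N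
  zetaPartial-tail s N {suc m} {n} (s≤s m≥) n≥ = begin
    S (suc m) - S n
      ≤⟨ ℚ.+-mono-≤
           (ℚ.≤-trans (subst (_≤ S (suc m) + + 1 / suc m) (ℚ.+-identityʳ (S (suc m)))
               (ℚ.+-monoʳ-≤ (S (suc m)) (frac≤ 0 1 1 (suc m) z≤n)))
             (zetaPartial-anti s (ℕ.≤⇒≤′ m≥)))
           (ℚ.neg-antimono-≤ (zetaPartial-mono s (ℕ.≤⇒≤′ n≥))) ⟩
    (S (suc N) + + 1 / suc N) - S (suc N)
      ≡⟨ solve 2 (λ a b → (a :+ b) :- a := b) refl (S (suc N)) (+ 1 / suc N) ⟩
    + 1 / suc N ∎
    where
    open ℚ.≤-Reasoning
    S = zetaPartial s

  archimedean : ∀ ε → 0ℚ < ε → ∃[ N ] (+ 1 / suc N < ε)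
  archimedean (mkℚ +[1+ p ] d c) _ = suc d , ℚ.toℚᵘ-cancel-< (ℚᵘ.≤-<-trans
    (ℚᵘ.≤-reflexive (ℚ.toℚᵘ-fromℚᵘ (mkℚᵘ (+ 1) (suc d))))
    (ℚᵘ.*<* (+<+ (ℕ.<-≤-trans (ℕ.≤-reflexive (cong suc (ℕ.*-identityˡ (suc d))))
      (ℕ.m≤m+n (suc (suc d)) (p ℕ.* suc (suc d)))))))
  archimedean (mkℚ (+ 0) d c) (*<* (+<+ ()))
  archimedean (mkℚ -[1+ p ] d c) (*<* ())

-- The Riemann zeta function at integers s ≥ 2, as the sum of its Dirichlet series.
ζ : (s : ℕ) → .{{NonTrivial s}} → ℝ
ζ s = mkℝ (zetaPartial s) prf
  where
  prf : ∀ ε → 0ℚ < ε → ∃[ N ] (∀ m n → N ℕ.≤ m → N ℕ.≤ n →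
        ∣ zetaPartial s m - zetaPartial s n ∣ < ε)
  prf ε ε>0 with archimedean ε ε>0
  ... | N , h = suc N , λ m n m≥ n≥ → ℚ.≤-<-trans
    (∣∣-≤ (zetaPartial-tail s N m≥ n≥)
      (subst (_≤ + 1 / suc N) (sym (neg-sub (zetaPartial s m) (zetaPartial s n)))
        (zetaPartial-tail s N n≥ m≥)))
    h

-- Domb numbers
D : ℕ → ℕ
D n = sum (map (λ k → (n C k) ℕ.^ 2 ℕ.* ((2 ℕ.* k) C k) ℕ.* ((2 ℕ.* (n ℕ.∸ k)) C (n ℕ.∸ k)))
               (upTo (suc n)))

fromℕ : ℕ → ℚ
fromℕ n = + n / 1

private
  nC0≡1 : ∀ n → n C 0 ≡ 1
  nC0≡1 n = trans (nCk≡nC[n∸k] {0} {n} z≤n) (nCn≡1 n)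

  nCk>0 : ∀ {n k} → k ℕ.≤ n → 0 ℕ.< n C k
  nCk>0 {n} {zero} _ = ℕ.≤-reflexive (sym (nC0≡1 n))
  nCk>0 {suc n} {suc k} (s≤s h) = ℕ.<-≤-trans (nCk>0 h)
    (ℕ.≤-trans (ℕ.m≤m+n (n C k) (n C suc k)) (ℕ.≤-reflexive (nCk+nC[k+1]≡[n+1]C[k+1] n k)))

D>0 : ∀ n → 0 ℕ.< D n
D>0 n = ℕ.<-≤-trans
  (ℕ.*-mono-≤ (ℕ.*-mono-≤ (ℕ.≤-reflexive (cong (ℕ._^ 2) (sym (nC0≡1 n)))) (ℕ.≤-refl {1}))
    (nCk>0 (ℕ.m≤m+n n (n ℕ.+ 0))))
  (ℕ.m≤m+n _ _)

D≢0 : ∀ n → ℚ.NonZero (fromℕ (D n))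
D≢0 n = ℚ.pos⇒nonZero (fromℕ (D n)) {{ℚ.normalize-pos (D n) 1 {{_}} {{ℕ.>-nonZero (D>0 n)}}}}

{-# OPTIONS --safe #-}

-- Let w k = C(2k,k) / k!², so that D n = n!² ∑_{k+m=n} w k * w m and k³ w k = 2 (2k - 1) w (k - 1).
-- Expanding (k + m)⁵ as k³ (k² + 5km + 10m²) + m³ (m² + 5km + 10k²) turns this first-order recurrence
-- into the recurrence of D. Nothing in that argument needs k and m to be natural numbers: if w is
-- continued to half-integers, the sum of the (suitably normalised) terms T n l = n!² w k * w m over
-- k = n + l + 1/2 and m = - l - 1/2, l ≥ 0, satisfies the same recurrence for n ≥ 1. Its value is
-- (1/3) ∑ 1/(2l+1)³ = 7/24 ζ(3) at n = 0, and 4 · 7/24 ζ(3) - 1 at n = 1, so it equals 7/24 ζ(3) D n - B n.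
-- As T n l ≤ 4ⁿ T 0 l while D n ≥ (n + 1) 4ⁿ / 2, dividing by D n gives the limit.
-- For the partial sums R n N over l < N all these identities hold up to O(1/N), so only rationals are needed.
module Submission where

open import Defs
open import Data.Nat as ℕ using (ℕ; zero; suc; NonZero; _!)
import Data.Nat.Properties as ℕ
open import Data.Nat.Combinatorics using (_C_; nCn≡1; nCk≡nC[n∸k]; nCk+nC[k+1]≡[n+1]C[k+1])
open import Data.Nat.ListAction using (sum)
open import Data.Nat.Tactic.RingSolver using (solve-∀)
open import Data.Integer as ℤ using (+_; -[1+_])
import Data.Integer.Properties as ℤ
open import Data.List using (map; applyUpTo)
open import Data.Maybe as Maybe using (Maybe)
open import Data.Product using (∃-syntax; _×_; _,_; proj₁; proj₂)
open import Data.Rational as ℚ hiding (NonZero)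
import Data.Rational.Properties as ℚ
import Data.Rational.Unnormalised as ℚᵘ
import Data.Rational.Unnormalised.Properties as ℚᵘ
open import Function using (_∘_; id)
open import Relation.Binary.PropositionalEquality
  using (_≡_; refl; sym; trans; cong; cong₂; subst; subst₂; module ≡-Reasoning)
open import Level using (0ℓ)
open import Relation.Nullary.Decidable using (dec⇒maybe)
import Algebra.Solver.Ring as RingSolver
import Algebra.Solver.Ring.AlmostCommutativeRing as ACR

-- Integers and natural numbers inside ℚ

toℚᵘ-/1 : ∀ i → toℚᵘ (i / 1) ℚᵘ.≃ ℚᵘ.mkℚᵘ i 0
toℚᵘ-/1 i = ℚ.toℚᵘ-fromℚᵘ (ℚᵘ.mkℚᵘ i 0)

/1-homo-+ : ∀ i j → (i ℤ.+ j) / 1 ≡ i / 1 + j / 1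
/1-homo-+ i j = ℚ.toℚᵘ-injective (ℚᵘ.≃-trans (toℚᵘ-/1 (i ℤ.+ j))
  (ℚᵘ.≃-sym (ℚᵘ.≃-trans (ℚ.toℚᵘ-homo-+ (i / 1) (j / 1))
    (ℚᵘ.≃-trans (ℚᵘ.+-cong (toℚᵘ-/1 i) (toℚᵘ-/1 j))
      (ℚᵘ.≃-reflexive (cong (λ k → ℚᵘ.mkℚᵘ k 0)
        (cong₂ ℤ._+_ (ℤ.*-identityʳ i) (ℤ.*-identityʳ j))))))))

/1-homo-* : ∀ i j → (i ℤ.* j) / 1 ≡ i / 1 * (j / 1)
/1-homo-* i j = ℚ.toℚᵘ-injective (ℚᵘ.≃-trans (toℚᵘ-/1 (i ℤ.* j))
  (ℚᵘ.≃-sym (ℚᵘ.≃-trans (ℚ.toℚᵘ-homo-* (i / 1) (j / 1))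
    (ℚᵘ.*-cong (toℚᵘ-/1 i) (toℚᵘ-/1 j)))))

/1-homo-neg : ∀ i → (ℤ.- i) / 1 ≡ - (i / 1)
/1-homo-neg i = ℚ.toℚᵘ-injective (ℚᵘ.≃-trans (toℚᵘ-/1 (ℤ.- i))
  (ℚᵘ.≃-sym (ℚᵘ.≃-trans (ℚ.toℚᵘ-homo‿- (i / 1)) (ℚᵘ.-‿cong (toℚᵘ-/1 i)))))

ℚ-ring : ACR.AlmostCommutativeRing 0ℓ 0ℓ
ℚ-ring = ACR.fromCommutativeRing ℚ.+-*-commutativeRing

/1-morphism : ℤ.+-*-rawRing ACR.-Raw-AlmostCommutative⟶ ℚ-ring
/1-morphism = record
  { ⟦_⟧    = _/ 1
  ; +-homo = /1-homo-+
  ; *-homo = /1-homo-*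
  ; -‿homo = /1-homo-neg
  ; 0-homo = refl
  ; 1-homo = refl
  }

/1-≟ : ∀ i j → Maybe (i / 1 ≡ j / 1)
/1-≟ i j = Maybe.map (cong (_/ 1)) (dec⇒maybe (i ℤ.≟ j))

-- The library's ℚ solver computes with rational coefficients, hence with gcds; integer ones are much cheaper.
module ℤ-coeff = RingSolver ℤ.+-*-rawRing ℚ-ring /1-morphism /1-≟
open ℤ-coeff using (solve; _:=_; _:+_; _:*_; _:-_; :-_; con; Polynomial)

fromℕ-+ : ∀ m n → fromℕ (m ℕ.+ n) ≡ fromℕ m + fromℕ n
fromℕ-+ m n = trans (cong (_/ 1) (ℤ.pos-+ m n)) (/1-homo-+ (+ m) (+ n))

fromℕ-* : ∀ m n → fromℕ (m ℕ.* n) ≡ fromℕ m * fromℕ n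
fromℕ-* m n = trans (cong (_/ 1) (ℤ.pos-* m n)) (/1-homo-* (+ m) (+ n))

fromℕ-suc : ∀ n → fromℕ (suc n) ≡ fromℕ n + 1ℚ
fromℕ-suc n = trans (cong fromℕ (ℕ.+-comm 1 n)) (fromℕ-+ n 1)

c : ∀ {n} → ℕ → Polynomial n
c k = con (+ k)

-- The shift by one makes every reciprocal total, without a nonzero side condition; 1/(2l + 1) is
-- thus `inv` at 2l.
inv : ℕ → ℚ
inv n = + 1 / suc n

fromℕ-inv : ∀ n → fromℕ (suc n) * inv n ≡ 1ℚ
fromℕ-inv n = ℚ.toℚᵘ-injective (ℚᵘ.≃-trans (ℚ.toℚᵘ-homo-* (fromℕ (suc n)) (inv n))
  (ℚᵘ.≃-trans (ℚᵘ.*-cong (toℚᵘ-/1 (+ suc n)) (ℚ.toℚᵘ-fromℚᵘ (ℚᵘ.mkℚᵘ (+ 1) n)))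
    (ℚᵘ.*≡* (cong +_ (trans (ℕ.*-comm (suc n ℕ.* 1) 1) (cong (1 ℕ.*_) (ℕ.*-comm (suc n) 1)))))))

infixr 8 _²  _³
_² _³ : ℚ → ℚ
x ² = x * x
x ³ = x * x * x

_:² _:³ : ∀ {n} → Polynomial n → Polynomial n
x :² = x :* x
x :³ = x :* x :* x

0≤fromℕ : ∀ n → 0ℚ ≤ fromℕ n
0≤fromℕ n = ℚ.nonNegative⁻¹ (fromℕ n) {{ℚ.normalize-nonNeg n 1}}

0<fromℕ-suc : ∀ n → 0ℚ < fromℕ (suc n)
0<fromℕ-suc n = ℚ.positive⁻¹ (fromℕ (suc n)) {{ℚ.normalize-pos (suc n) 1}}

0≤inv : ∀ n → 0ℚ ≤ inv n
0≤inv n = ℚ.nonNegative⁻¹ (inv n) {{ℚ.normalize-nonNeg 1 (suc n)}}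

*-monoˡ : ∀ {x y z} → 0ℚ ≤ x → y ≤ z → x * y ≤ x * z
*-monoˡ {x} 0≤x = ℚ.*-monoˡ-≤-nonNeg x {{nonNegative 0≤x}}

infixl 6 _⊕_
infixl 7 _⊗_

_⊕_ : ∀ {x y} → 0ℚ ≤ x → 0ℚ ≤ y → 0ℚ ≤ x + y
_⊕_ = ℚ.+-mono-≤

_⊗_ : ∀ {x y} → 0ℚ ≤ x → 0ℚ ≤ y → 0ℚ ≤ x * y
_⊗_ {x} {y} 0≤x 0≤y = subst (_≤ x * y) (ℚ.*-zeroʳ x) (*-monoˡ 0≤x 0≤y)

-- Reduces a polynomial inequality to an identity for the ring solver: the difference is exhibited
-- as `z`, and `_⊕_` and `_⊗_` build its nonnegativity along its own expression.
≤-excess : ∀ {x y z} → 0ℚ ≤ z → x + z ≡ y → x ≤ y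
≤-excess {x} {z = z} 0≤z eq = subst₂ _≤_ (ℚ.+-identityʳ x) eq (ℚ.+-monoʳ-≤ x 0≤z)

fromℕ-mono : ∀ {m n} → m ℕ.≤ n → fromℕ m ≤ fromℕ n
fromℕ-mono {m} {n} m≤n = ≤-excess (0≤fromℕ (n ℕ.∸ m))
  (trans (sym (fromℕ-+ m (n ℕ.∸ m))) (cong fromℕ (ℕ.m+[n∸m]≡n m≤n)))

*-cancelˡ-≡ : ∀ k {x y} → fromℕ (suc k) * x ≡ fromℕ (suc k) * y → x ≡ y
*-cancelˡ-≡ k {x} {y} eq = trans (undo x) (trans (cong (inv k *_) eq) (sym (undo y)))
  where
  undo : ∀ z → z ≡ inv k * (fromℕ (suc k) * z)
  undo z = trans (sym (ℚ.*-identityˡ z)) (trans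
    (cong (_* z) (trans (sym (fromℕ-inv k)) (ℚ.*-comm (fromℕ (suc k)) (inv k))))
    (ℚ.*-assoc (inv k) (fromℕ (suc k)) z))

*-cancelˡ-≤ : ∀ k {x y} → fromℕ (suc k) * x ≤ fromℕ (suc k) * y → x ≤ y
*-cancelˡ-≤ k = ℚ.*-cancelˡ-≤-pos (fromℕ (suc k)) {{positive (0<fromℕ-suc k)}}

-- The recurrence of the Domb numbers

infix 10 ∑△_

-- The sum over the antidiagonal k + m = n. Carrying both indices keeps truncated subtraction out of
-- the algebra and makes the symmetry of k and m visible.
∑△_ : (ℕ → ℕ → ℚ) → ℕ → ℚ
(∑△ F) zero    = F 0 0
(∑△ F) (suc n) = F 0 (suc n) + (∑△ (F ∘ suc)) n

∑△-cong : ∀ {F G} n → (∀ k m → k ℕ.+ m ≡ n → F k m ≡ G k m) → (∑△ F) n ≡ (∑△ G) n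
∑△-cong zero    eq = eq 0 0 refl
∑△-cong (suc n) eq = cong₂ _+_ (eq 0 (suc n) refl) (∑△-cong n λ k m k+m≡n → eq (suc k) m (cong suc k+m≡n))

∑△-+ : ∀ F G n → (∑△ (λ k m → F k m + G k m)) n ≡ (∑△ F) n + (∑△ G) n
∑△-+ F G zero    = refl
∑△-+ F G (suc n) = trans (cong (_+_ (F 0 (suc n) + G 0 (suc n))) (∑△-+ (F ∘ suc) (G ∘ suc) n))
  (solve 4 (λ a b x y → (a :+ b) :+ (x :+ y) := (a :+ x) :+ (b :+ y)) refl
    (F 0 (suc n)) (G 0 (suc n)) ((∑△ (F ∘ suc)) n) ((∑△ (G ∘ suc)) n))

∑△-* : ∀ x F n → (∑△ (λ k m → x * F k m)) n ≡ x * (∑△ F) n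
∑△-* x F zero    = refl
∑△-* x F (suc n) = trans (cong (_+_ (x * F 0 (suc n))) (∑△-* x (F ∘ suc) n))
  (sym (ℚ.*-distribˡ-+ x (F 0 (suc n)) ((∑△ (F ∘ suc)) n)))

∑△-shiftˡ : ∀ F n → (∀ m → F 0 m ≡ 0ℚ) → (∑△ F) (suc n) ≡ (∑△ (λ k m → F (suc k) m)) n
∑△-shiftˡ F n eq = trans (cong (_+ (∑△ (F ∘ suc)) n) (eq (suc n))) (ℚ.+-identityˡ ((∑△ (F ∘ suc)) n))

∑△-shiftʳ : ∀ F n → (∀ k → F k 0 ≡ 0ℚ) → (∑△ F) (suc n) ≡ (∑△ (λ k m → F k (suc m))) n
∑△-shiftʳ F zero    eq = trans (cong (_+_ (F 0 1)) (eq 1)) (ℚ.+-identityʳ (F 0 1))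
∑△-shiftʳ F (suc n) eq = cong (_+_ (F 0 (suc (suc n)))) (∑△-shiftʳ (F ∘ suc) n (eq ∘ suc))

-- The induction needs a general `h`, because the tail of `applyUpTo h` is `applyUpTo (h ∘ suc)`;
-- only `id` is wanted in the end.
fromℕ-sum : ∀ (f h : ℕ → ℕ) (F : ℕ → ℕ → ℚ) n → (∀ k m → k ℕ.+ m ≡ n → fromℕ (f (h k)) ≡ F k m) →
            fromℕ (sum (map f (applyUpTo h (suc n)))) ≡ (∑△ F) n
fromℕ-sum f h F zero    eq = trans (cong fromℕ (ℕ.+-identityʳ (f (h 0)))) (eq 0 0 refl)
fromℕ-sum f h F (suc n) eq = trans (fromℕ-+ (f (h 0)) (sum (map f (applyUpTo (h ∘ suc) (suc n)))))
  (cong₂ _+_ (eq 0 (suc n) refl)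
    (fromℕ-sum f (h ∘ suc) (F ∘ suc) n λ k m k+m≡n → eq (suc k) m (cong suc k+m≡n)))

-- Binomial coefficients through inverse factorials

nC0≡1 : ∀ n → n C 0 ≡ 1
nC0≡1 n = trans (nCk≡nC[n∸k] {0} {n} ℕ.z≤n) (nCn≡1 n)

-- Pascal's rule splits the product into (k + 1) n! and (m + 1) n! with n = k + m + 1, and these add
-- up to (n + 1)!.
C-! : ∀ k m → ((k ℕ.+ m) C k) ℕ.* (k ! ℕ.* m !) ≡ (k ℕ.+ m) !
C-! zero    m = trans (cong (ℕ._* (1 ℕ.* m !)) (nC0≡1 m)) (trans (ℕ.*-identityˡ (1 ℕ.* m !)) (ℕ.*-identityˡ (m !)))
C-! (suc k) zero = trans (cong (ℕ._* (suc k ! ℕ.* 1))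
    (trans (cong (_C suc k) (ℕ.+-identityʳ (suc k))) (nCn≡1 (suc k))))
  (trans (ℕ.*-identityˡ (suc k ! ℕ.* 1)) (trans (ℕ.*-identityʳ (suc k !)) (cong _! (sym (ℕ.+-identityʳ (suc k))))))
C-! (suc k) (suc m) = begin
  (suc n C suc k) ℕ.* (suc k ! ℕ.* suc m !)
    ≡⟨ cong (ℕ._* (suc k ! ℕ.* suc m !)) (nCk+nC[k+1]≡[n+1]C[k+1] n k) ⟨
  (n C k ℕ.+ n C suc k) ℕ.* (suc k ! ℕ.* suc m !)
    ≡⟨ split k m (k !) (m !) (n C k) (n C suc k) ⟩
  suc k ℕ.* ((n C k) ℕ.* (k ! ℕ.* suc m !)) ℕ.+ suc m ℕ.* ((n C suc k) ℕ.* (suc k ! ℕ.* m !))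
    ≡⟨ cong₂ (λ a b → suc k ℕ.* a ℕ.+ suc m ℕ.* b) (C-! k (suc m))
         (trans (cong (λ j → (j C suc k) ℕ.* (suc k ! ℕ.* m !)) (ℕ.+-suc k m))
           (trans (C-! (suc k) m) (cong _! (sym (ℕ.+-suc k m))))) ⟩
  suc k ℕ.* n ! ℕ.+ suc m ℕ.* n !
    ≡⟨ ℕ.*-distribʳ-+ (n !) (suc k) (suc m) ⟨
  suc n ! ∎
  where
  open ≡-Reasoning
  n = k ℕ.+ suc m
  split : ∀ k m a b x y → (x ℕ.+ y) ℕ.* ((suc k ℕ.* a) ℕ.* (suc m ℕ.* b))
    ≡ suc k ℕ.* (x ℕ.* (a ℕ.* (suc m ℕ.* b))) ℕ.+ suc m ℕ.* (y ℕ.* ((suc k ℕ.* a) ℕ.* b))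
  split = solve-∀

_!⁻¹ : ℕ → ℚ
zero  !⁻¹ = 1ℚ
suc n !⁻¹ = inv n * n !⁻¹

!-inverse : ∀ n → fromℕ (n !) * n !⁻¹ ≡ 1ℚ
!-inverse zero    = refl
!-inverse (suc n) = begin
  fromℕ (suc n ℕ.* n !) * (inv n * n !⁻¹)
    ≡⟨ cong (_* (inv n * n !⁻¹)) (fromℕ-* (suc n) (n !)) ⟩
  fromℕ (suc n) * fromℕ (n !) * (inv n * n !⁻¹)
    ≡⟨ solve 4 (λ a b x y → a :* b :* (x :* y) := (a :* x) :* (b :* y)) refl (fromℕ (suc n)) (fromℕ (n !)) (inv n) (n !⁻¹) ⟩
  (fromℕ (suc n) * inv n) * (fromℕ (n !) * n !⁻¹)
    ≡⟨ cong₂ _*_ (fromℕ-inv n) (!-inverse n) ⟩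
  1ℚ ∎
  where open ≡-Reasoning

fromℕ-C : ∀ k m → fromℕ ((k ℕ.+ m) C k) ≡ fromℕ ((k ℕ.+ m) !) * (k !⁻¹ * m !⁻¹)
fromℕ-C k m = begin
  fromℕ b
    ≡⟨ trans (ℚ.*-identityʳ _) (ℚ.*-identityʳ _) ⟨
  fromℕ b * 1ℚ * 1ℚ
    ≡⟨ cong₂ (λ x y → fromℕ b * x * y) (!-inverse k) (!-inverse m) ⟨
  fromℕ b * (fromℕ (k !) * k !⁻¹) * (fromℕ (m !) * m !⁻¹)
    ≡⟨ solve 5 (λ b x x′ y y′ → b :* (x :* x′) :* (y :* y′) := (b :* (x :* y)) :* (x′ :* y′)) refl
         (fromℕ b) (fromℕ (k !)) (k !⁻¹) (fromℕ (m !)) (m !⁻¹) ⟩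
  fromℕ b * (fromℕ (k !) * fromℕ (m !)) * (k !⁻¹ * m !⁻¹)
    ≡⟨ cong (λ x → fromℕ b * x * (k !⁻¹ * m !⁻¹)) (fromℕ-* (k !) (m !)) ⟨
  fromℕ b * fromℕ (k ! ℕ.* m !) * (k !⁻¹ * m !⁻¹)
    ≡⟨ cong (_* (k !⁻¹ * m !⁻¹)) (trans (sym (fromℕ-* b (k ! ℕ.* m !))) (cong fromℕ (C-! k m))) ⟩
  fromℕ ((k ℕ.+ m) !) * (k !⁻¹ * m !⁻¹) ∎
  where
  open ≡-Reasoning
  b = (k ℕ.+ m) C k

-- C(2k,k) / k!² written as (2k)! / k!⁴, so that only factorials enter its recurrence.
w : ℕ → ℚ
w k = fromℕ ((2 ℕ.* k) !) * (k !⁻¹ ² * k !⁻¹ ²)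

central-C : ∀ k → fromℕ ((2 ℕ.* k) C k) * k !⁻¹ ² ≡ w k
central-C k = trans (cong (_* k !⁻¹ ²)
    (subst (λ j → fromℕ (j C k) ≡ fromℕ (j !) * k !⁻¹ ²) (cong (k ℕ.+_) (sym (ℕ.+-identityʳ k))) (fromℕ-C k k)))
  (ℚ.*-assoc (fromℕ ((2 ℕ.* k) !)) (k !⁻¹ ²) (k !⁻¹ ²))

-- (2k + 2)! contributes 2 (k + 1) (2k + 1), and one factor k + 1 cancels against the fourth power
-- in the denominator, leaving a cube.
w-suc : ∀ k → fromℕ (suc k) ³ * w (suc k) ≡ fromℕ 2 * (fromℕ 2 * fromℕ k + fromℕ 1) * w k
w-suc k = begin
  s ³ * (fromℕ ((2 ℕ.* suc k) !) * ((inv k * i) ² * (inv k * i) ²))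
    ≡⟨ cong (λ z → s ³ * (z * ((inv k * i) ² * (inv k * i) ²))) fac ⟩
  s ³ * (fromℕ 2 * s * (fromℕ 2 * x + fromℕ 1) * f * ((inv k * i) ² * (inv k * i) ²))
    ≡⟨ solve 5 (λ s x f v i → s :³ :* (c 2 :* s :* (c 2 :* x :+ c 1) :* f :* ((v :* i) :² :* (v :* i) :²))
          := (s :* v) :² :* (s :* v) :² :* (c 2 :* (c 2 :* x :+ c 1) :* (f :* (i :² :* i :²)))) refl s x f (inv k) i ⟩
  (s * inv k) ² * (s * inv k) ² * (fromℕ 2 * (fromℕ 2 * x + fromℕ 1) * w k)
    ≡⟨ cong (λ z → z ² * z ² * (fromℕ 2 * (fromℕ 2 * x + fromℕ 1) * w k)) (fromℕ-inv k) ⟩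
  1ℚ * (fromℕ 2 * (fromℕ 2 * x + fromℕ 1) * w k)
    ≡⟨ ℚ.*-identityˡ _ ⟩
  fromℕ 2 * (fromℕ 2 * x + fromℕ 1) * w k ∎
  where
  open ≡-Reasoning
  s = fromℕ (suc k)
  x = fromℕ k
  i = k !⁻¹
  f = fromℕ ((2 ℕ.* k) !)
  fac-ℕ : (2 ℕ.* suc k) ! ≡ 2 ℕ.* suc k ℕ.* (2 ℕ.* k ℕ.+ 1) ℕ.* (2 ℕ.* k) !
  fac-ℕ = trans (cong _! (two k)) (three k ((2 ℕ.* k) !))
    where
    two : ∀ k → 2 ℕ.* suc k ≡ suc (suc (2 ℕ.* k))
    two = solve-∀
    three : ∀ k f → suc (suc (2 ℕ.* k)) ℕ.* (suc (2 ℕ.* k) ℕ.* f) ≡ 2 ℕ.* suc k ℕ.* (2 ℕ.* k ℕ.+ 1) ℕ.* f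
    three = solve-∀
  fac : fromℕ ((2 ℕ.* suc k) !) ≡ fromℕ 2 * s * (fromℕ 2 * x + fromℕ 1) * f
  fac = trans (cong fromℕ fac-ℕ) (trans (fromℕ-* (2 ℕ.* suc k ℕ.* (2 ℕ.* k ℕ.+ 1)) ((2 ℕ.* k) !))
    (cong (_* f) (trans (fromℕ-* (2 ℕ.* suc k) (2 ℕ.* k ℕ.+ 1))
      (cong₂ _*_ (fromℕ-* 2 (suc k)) (trans (fromℕ-+ (2 ℕ.* k) 1) (cong (_+ fromℕ 1) (fromℕ-* 2 k)))))))

d : ℕ → ℚ
d = ∑△ (λ k m → w k * w m)

fromℕ-D : ∀ n → fromℕ (D n) ≡ fromℕ (n !) ² * d n
fromℕ-D n = trans
  (fromℕ-sum (λ k → (n C k) ℕ.^ 2 ℕ.* ((2 ℕ.* k) C k) ℕ.* ((2 ℕ.* (n ℕ.∸ k)) C (n ℕ.∸ k))) id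
    (λ k m → fromℕ (n !) ² * (w k * w m)) n term)
  (∑△-* (fromℕ (n !) ²) (λ k m → w k * w m) n)
  where
  open ≡-Reasoning
  term : ∀ k m → k ℕ.+ m ≡ n →
    fromℕ ((n C k) ℕ.^ 2 ℕ.* ((2 ℕ.* k) C k) ℕ.* ((2 ℕ.* (n ℕ.∸ k)) C (n ℕ.∸ k))) ≡ fromℕ (n !) ² * (w k * w m)
  term k m refl = begin
    fromℕ ((n C k) ℕ.^ 2 ℕ.* ((2 ℕ.* k) C k) ℕ.* ((2 ℕ.* (n ℕ.∸ k)) C (n ℕ.∸ k)))
      ≡⟨ cong (λ j → fromℕ ((n C k) ℕ.^ 2 ℕ.* ((2 ℕ.* k) C k) ℕ.* ((2 ℕ.* j) C j))) (ℕ.m+n∸m≡n k m) ⟩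
    fromℕ ((n C k) ℕ.^ 2 ℕ.* ((2 ℕ.* k) C k) ℕ.* ((2 ℕ.* m) C m))
      ≡⟨ trans (fromℕ-* ((n C k) ℕ.^ 2 ℕ.* ((2 ℕ.* k) C k)) ((2 ℕ.* m) C m))
           (cong (_* fromℕ ((2 ℕ.* m) C m)) (trans (fromℕ-* ((n C k) ℕ.^ 2) ((2 ℕ.* k) C k))
             (cong (_* fromℕ ((2 ℕ.* k) C k)) (trans (cong fromℕ (cong ((n C k) ℕ.*_) (ℕ.*-identityʳ (n C k))))
               (fromℕ-* (n C k) (n C k)))))) ⟩
    fromℕ (n C k) ² * fromℕ ((2 ℕ.* k) C k) * fromℕ ((2 ℕ.* m) C m)
      ≡⟨ cong (λ z → z ² * fromℕ ((2 ℕ.* k) C k) * fromℕ ((2 ℕ.* m) C m)) (fromℕ-C k m) ⟩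
    (fromℕ (n !) * (k !⁻¹ * m !⁻¹)) ² * fromℕ ((2 ℕ.* k) C k) * fromℕ ((2 ℕ.* m) C m)
      ≡⟨ solve 5 (λ f x y a b → (f :* (x :* y)) :² :* a :* b := f :² :* ((a :* x :²) :* (b :* y :²))) refl
           (fromℕ (n !)) (k !⁻¹) (m !⁻¹) (fromℕ ((2 ℕ.* k) C k)) (fromℕ ((2 ℕ.* m) C m)) ⟩
    fromℕ (n !) ² * ((fromℕ ((2 ℕ.* k) C k) * k !⁻¹ ²) * (fromℕ ((2 ℕ.* m) C m) * m !⁻¹ ²))
      ≡⟨ cong (fromℕ (n !) ² *_) (cong₂ _*_ (central-C k) (central-C m)) ⟩
    fromℕ (n !) ² * (w k * w m) ∎

-- Antidiagonal sums with polynomial weights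

weighted : (ℚ → ℚ → ℚ) → ℕ → ℚ
weighted f = ∑△ (λ k m → f (fromℕ k) (fromℕ m) * (w k * w m))

weighted-cong : ∀ {f g} n → (∀ x y → f x y ≡ g x y) → weighted f n ≡ weighted g n
weighted-cong n eq = ∑△-cong n λ k m _ → cong (_* (w k * w m)) (eq (fromℕ k) (fromℕ m))

weighted-+ : ∀ f g n → weighted (λ x y → f x y + g x y) n ≡ weighted f n + weighted g n
weighted-+ f g n = trans
  (∑△-cong n λ k m _ → ℚ.*-distribʳ-+ (w k * w m) (f (fromℕ k) (fromℕ m)) (g (fromℕ k) (fromℕ m)))
  (∑△-+ (λ k m → f (fromℕ k) (fromℕ m) * (w k * w m)) (λ k m → g (fromℕ k) (fromℕ m) * (w k * w m)) n)

weighted-* : ∀ a f n → weighted (λ x y → a * f x y) n ≡ a * weighted f n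
weighted-* a f n = trans
  (∑△-cong n λ k m _ → ℚ.*-assoc a (f (fromℕ k) (fromℕ m)) (w k * w m))
  (∑△-* a (λ k m → f (fromℕ k) (fromℕ m) * (w k * w m)) n)

-- A weight that depends on k + m alone is constant on the antidiagonal and comes out of the sum.
weighted-degree : ∀ (f : ℚ → ℚ) n → weighted (λ x y → f (x + y)) n ≡ f (fromℕ n) * d n
weighted-degree f n = trans
  (∑△-cong n λ k m k+m≡n → cong (λ z → f z * (w k * w m))
    (trans (sym (fromℕ-+ k m)) (cong fromℕ k+m≡n)))
  (∑△-* (f (fromℕ n)) (λ k m → w k * w m) n)

-- The factor k³ kills the term k = 0 and, after k is shifted by one, is absorbed by the recurrence
-- of `w`. So a sum at level n + 1 becomes one at level n.
weighted-shiftˡ : ∀ (f : ℚ → ℚ → ℚ) n → weighted (λ x y → x ³ * f x y) (suc n)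
                        ≡ weighted (λ x y → fromℕ 2 * (fromℕ 2 * x + 1ℚ) * f (x + 1ℚ) y) n
weighted-shiftˡ f n = trans
  (∑△-shiftˡ (λ k m → fromℕ k ³ * f (fromℕ k) (fromℕ m) * (w k * w m)) n λ m → trans
    (cong (_* (w 0 * w m)) (ℚ.*-zeroˡ (f 0ℚ (fromℕ m)))) (ℚ.*-zeroˡ (w 0 * w m)))
  (∑△-cong n λ k m _ → begin
    fromℕ (suc k) ³ * f (fromℕ (suc k)) (fromℕ m) * (w (suc k) * w m)
      ≡⟨ solve 4 (λ a b u v → a :* b :* (u :* v) := b :* (a :* u) :* v) refl
           (fromℕ (suc k) ³) (f (fromℕ (suc k)) (fromℕ m)) (w (suc k)) (w m) ⟩
    f (fromℕ (suc k)) (fromℕ m) * (fromℕ (suc k) ³ * w (suc k)) * w m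
      ≡⟨ cong₂ (λ x z → f x (fromℕ m) * z * w m) (fromℕ-suc k) (w-suc k) ⟩
    f (fromℕ k + 1ℚ) (fromℕ m) * (fromℕ 2 * (fromℕ 2 * fromℕ k + 1ℚ) * w k) * w m
      ≡⟨ solve 4 (λ a b u v → b :* (a :* u) :* v := a :* b :* (u :* v)) refl
           (fromℕ 2 * (fromℕ 2 * fromℕ k + 1ℚ)) (f (fromℕ k + 1ℚ) (fromℕ m)) (w k) (w m) ⟩
    fromℕ 2 * (fromℕ 2 * fromℕ k + 1ℚ) * f (fromℕ k + 1ℚ) (fromℕ m) * (w k * w m) ∎)
  where open ≡-Reasoning

weighted-shiftʳ : ∀ (f : ℚ → ℚ → ℚ) n → weighted (λ x y → y ³ * f x y) (suc n)
                        ≡ weighted (λ x y → fromℕ 2 * (fromℕ 2 * y + 1ℚ) * f x (y + 1ℚ)) n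
weighted-shiftʳ f n = trans
  (∑△-shiftʳ (λ k m → fromℕ m ³ * f (fromℕ k) (fromℕ m) * (w k * w m)) n λ k → trans
    (cong (_* (w k * w 0)) (ℚ.*-zeroˡ (f (fromℕ k) 0ℚ))) (ℚ.*-zeroˡ (w k * w 0)))
  (∑△-cong n λ k m _ → begin
    fromℕ (suc m) ³ * f (fromℕ k) (fromℕ (suc m)) * (w k * w (suc m))
      ≡⟨ solve 4 (λ a b u v → a :* b :* (u :* v) := b :* (a :* v) :* u) refl
           (fromℕ (suc m) ³) (f (fromℕ k) (fromℕ (suc m))) (w k) (w (suc m)) ⟩
    f (fromℕ k) (fromℕ (suc m)) * (fromℕ (suc m) ³ * w (suc m)) * w k
      ≡⟨ cong₂ (λ y z → f (fromℕ k) y * z * w k) (fromℕ-suc m) (w-suc m) ⟩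
    f (fromℕ k) (fromℕ m + 1ℚ) * (fromℕ 2 * (fromℕ 2 * fromℕ m + 1ℚ) * w m) * w k
      ≡⟨ solve 4 (λ a b u v → b :* (a :* v) :* u := a :* b :* (u :* v)) refl
           (fromℕ 2 * (fromℕ 2 * fromℕ m + 1ℚ)) (f (fromℕ k) (fromℕ m + 1ℚ)) (w k) (w m) ⟩
    fromℕ 2 * (fromℕ 2 * fromℕ m + 1ℚ) * f (fromℕ k) (fromℕ m + 1ℚ) * (w k * w m) ∎)
  where open ≡-Reasoning

-- The middle coefficient 2 (2n + 1) (5n² + 5n + 2) of the recurrence.
P : ℚ → ℚ
P x = fromℕ 2 * (fromℕ 2 * x + 1ℚ) * (fromℕ 5 * x ² + fromℕ 5 * x + fromℕ 2)

-- The two shifted weights 2 (2k + 1) and 2 (2m + 1) add up to 4 (k + m + 1). This evaluates the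
-- remainder in `d-step` one level further down, which makes the recurrence second order.
weighted-cubes : ∀ n → weighted (λ x y → x ³ + y ³) (suc n) ≡ fromℕ 4 * fromℕ (suc n) * d n
weighted-cubes n = begin
  weighted (λ x y → x ³ + y ³) (suc n)
    ≡⟨ weighted-cong (suc n) (solve 2 (λ x y → x :³ :+ y :³ := x :³ :* c 1 :+ y :³ :* c 1) refl) ⟩
  weighted (λ x y → x ³ * 1ℚ + y ³ * 1ℚ) (suc n)
    ≡⟨ weighted-+ (λ x y → x ³ * 1ℚ) (λ x y → y ³ * 1ℚ) (suc n) ⟩
  weighted (λ x y → x ³ * 1ℚ) (suc n) + weighted (λ x y → y ³ * 1ℚ) (suc n)
    ≡⟨ cong₂ _+_ (weighted-shiftˡ (λ _ _ → 1ℚ) n) (weighted-shiftʳ (λ _ _ → 1ℚ) n) ⟩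
  weighted (λ x y → fromℕ 2 * (fromℕ 2 * x + 1ℚ) * 1ℚ) n + weighted (λ x y → fromℕ 2 * (fromℕ 2 * y + 1ℚ) * 1ℚ) n
    ≡⟨ weighted-+ (λ x y → fromℕ 2 * (fromℕ 2 * x + 1ℚ) * 1ℚ) (λ x y → fromℕ 2 * (fromℕ 2 * y + 1ℚ) * 1ℚ) n ⟨
  weighted (λ x y → fromℕ 2 * (fromℕ 2 * x + 1ℚ) * 1ℚ + fromℕ 2 * (fromℕ 2 * y + 1ℚ) * 1ℚ) n
    ≡⟨ weighted-cong n (solve 2 (λ x y → c 2 :* (c 2 :* x :+ c 1) :* c 1 :+ c 2 :* (c 2 :* y :+ c 1) :* c 1
         := c 4 :* (x :+ y :+ c 1)) refl) ⟩
  weighted (λ x y → fromℕ 4 * (x + y + 1ℚ)) n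
    ≡⟨ weighted-degree (λ z → fromℕ 4 * (z + 1ℚ)) n ⟩
  fromℕ 4 * (fromℕ n + 1ℚ) * d n
    ≡⟨ cong (λ z → fromℕ 4 * z * d n) (fromℕ-suc n) ⟨
  fromℕ 4 * fromℕ (suc n) * d n ∎
  where open ≡-Reasoning

-- Both halves of the expansion of (k + m)⁵ carry a cube and can be shifted down. The resulting
-- weight is a function of k + m except for -16 (k³ + m³).
d-step : ∀ n → fromℕ (suc n) ² * fromℕ (suc n) ³ * d (suc n)
             ≡ P (fromℕ n) * d n + - fromℕ 16 * weighted (λ x y → x ³ + y ³) n
d-step n = begin
  fromℕ (suc n) ² * fromℕ (suc n) ³ * d (suc n)
    ≡⟨ weighted-degree (λ z → z ² * z ³) (suc n) ⟨
  weighted (λ x y → (x + y) ² * (x + y) ³) (suc n)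
    ≡⟨ weighted-cong (suc n) (solve 2 (λ x y → (x :+ y) :² :* (x :+ y) :³
         := x :³ :* (x :² :+ c 5 :* x :* y :+ c 10 :* y :²) :+ y :³ :* (y :² :+ c 5 :* x :* y :+ c 10 :* x :²)) refl) ⟩
  weighted (λ x y → x ³ * f x y + y ³ * g x y) (suc n)
    ≡⟨ weighted-+ (λ x y → x ³ * f x y) (λ x y → y ³ * g x y) (suc n) ⟩
  weighted (λ x y → x ³ * f x y) (suc n) + weighted (λ x y → y ³ * g x y) (suc n)
    ≡⟨ cong₂ _+_ (weighted-shiftˡ f n) (weighted-shiftʳ g n) ⟩
  weighted (λ x y → fromℕ 2 * (fromℕ 2 * x + 1ℚ) * f (x + 1ℚ) y) n
    + weighted (λ x y → fromℕ 2 * (fromℕ 2 * y + 1ℚ) * g x (y + 1ℚ)) n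
    ≡⟨ weighted-+ (λ x y → fromℕ 2 * (fromℕ 2 * x + 1ℚ) * f (x + 1ℚ) y)
         (λ x y → fromℕ 2 * (fromℕ 2 * y + 1ℚ) * g x (y + 1ℚ)) n ⟨
  weighted (λ x y → fromℕ 2 * (fromℕ 2 * x + 1ℚ) * f (x + 1ℚ) y + fromℕ 2 * (fromℕ 2 * y + 1ℚ) * g x (y + 1ℚ)) n
    ≡⟨ weighted-cong n (solve 2 (λ x y →
         c 2 :* (c 2 :* x :+ c 1) :* ((x :+ c 1) :² :+ c 5 :* (x :+ c 1) :* y :+ c 10 :* y :²)
           :+ c 2 :* (c 2 :* y :+ c 1) :* ((y :+ c 1) :² :+ c 5 :* x :* (y :+ c 1) :+ c 10 :* x :²)
         := c 2 :* (c 2 :* (x :+ y) :+ c 1) :* (c 5 :* (x :+ y) :² :+ c 5 :* (x :+ y) :+ c 2)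
           :+ con -[1+ 15 ] :* (x :³ :+ y :³)) refl) ⟩
  weighted (λ x y → P (x + y) + - fromℕ 16 * (x ³ + y ³)) n
    ≡⟨ weighted-+ (λ x y → P (x + y)) (λ x y → - fromℕ 16 * (x ³ + y ³)) n ⟩
  weighted (λ x y → P (x + y)) n + weighted (λ x y → - fromℕ 16 * (x ³ + y ³)) n
    ≡⟨ cong₂ _+_ (weighted-degree P n) (weighted-* (- fromℕ 16) (λ x y → x ³ + y ³) n) ⟩
  P (fromℕ n) * d n + - fromℕ 16 * weighted (λ x y → x ³ + y ³) n ∎
  where
  open ≡-Reasoning
  f g : ℚ → ℚ → ℚ
  f x y = x ² + fromℕ 5 * x * y + fromℕ 10 * y ²
  g x y = y ² + fromℕ 5 * x * y + fromℕ 10 * x ²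

D-recurrence : ∀ n → fromℕ (suc (suc n)) ³ * fromℕ (D (suc (suc n)))
  ≡ P (fromℕ (suc n)) * fromℕ (D (suc n)) - fromℕ 64 * fromℕ (suc n) ³ * fromℕ (D n)
D-recurrence n = begin
  s₂ ³ * fromℕ (D (suc (suc n)))
    ≡⟨ cong (s₂ ³ *_) (trans (fromℕ-D (suc (suc n)))
         (cong (λ z → z ² * d (suc (suc n))) (trans (fromℕ-* (suc (suc n)) (suc n !))
           (cong (s₂ *_) (fromℕ-* (suc n) (n !)))))) ⟩
  s₂ ³ * ((s₂ * (s₁ * f)) ² * d (suc (suc n)))
    -- The square of n + 2 inside (n + 2)!² raises the cube to the fifth power that `d-step` needs.
    ≡⟨ solve 4 (λ s₂ s₁ f d → s₂ :³ :* ((s₂ :* (s₁ :* f)) :² :* d) := (s₁ :* f) :² :* (s₂ :² :* s₂ :³ :* d)) refl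
         s₂ s₁ f (d (suc (suc n))) ⟩
  (s₁ * f) ² * (s₂ ² * s₂ ³ * d (suc (suc n)))
    ≡⟨ cong ((s₁ * f) ² *_) (trans (d-step (suc n))
         (cong (λ z → P s₁ * d (suc n) + - fromℕ 16 * z) (weighted-cubes n))) ⟩
  (s₁ * f) ² * (P s₁ * d (suc n) + - fromℕ 16 * (fromℕ 4 * s₁ * d n))
    ≡⟨ solve 5 (λ s₁ f p d₁ d₀ → (s₁ :* f) :² :* (p :* d₁ :+ con -[1+ 15 ] :* (c 4 :* s₁ :* d₀))
         := p :* ((s₁ :* f) :² :* d₁) :- c 64 :* s₁ :³ :* (f :² :* d₀)) refl s₁ f (P s₁) (d (suc n)) (d n) ⟩
  P s₁ * ((s₁ * f) ² * d (suc n)) - fromℕ 64 * s₁ ³ * (f ² * d n)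
    ≡⟨ cong₂ (λ a b → P s₁ * a - fromℕ 64 * s₁ ³ * b)
         (trans (cong (λ z → z ² * d (suc n)) (sym (fromℕ-* (suc n) (n !)))) (sym (fromℕ-D (suc n)))) (sym (fromℕ-D n)) ⟩
  P s₁ * fromℕ (D (suc n)) - fromℕ 64 * s₁ ³ * fromℕ (D n) ∎
  where
  open ≡-Reasoning
  s₂ = fromℕ (suc (suc n))
  s₁ = fromℕ (suc n)
  f = fromℕ (n !)

-- The half-integer sums

fromℕ-suc² : ∀ n → fromℕ (suc (suc n)) ≡ fromℕ n + fromℕ 2
fromℕ-suc² n = trans (cong fromℕ (ℕ.+-comm 2 n)) (fromℕ-+ n 2)

fromℕ-odd : ∀ n → fromℕ (suc (2 ℕ.* n)) ≡ fromℕ 2 * fromℕ n + 1ℚ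
fromℕ-odd n = trans (fromℕ-suc (2 ℕ.* n)) (cong (_+ 1ℚ) (fromℕ-* 2 n))

fromℕ-odd₂ : ∀ n l → fromℕ (suc (2 ℕ.* suc (n ℕ.+ l))) ≡ fromℕ 2 * (fromℕ l + fromℕ n) + fromℕ 3
fromℕ-odd₂ n l = trans (fromℕ-odd (suc (n ℕ.+ l))) (trans
  (cong (λ z → fromℕ 2 * z + 1ℚ) (trans (fromℕ-suc (n ℕ.+ l)) (cong (_+ 1ℚ) (fromℕ-+ n l))))
  (solve 2 (λ x y → c 2 :* (y :+ x :+ c 1) :+ c 1 := c 2 :* (x :+ y) :+ c 3) refl (fromℕ l) (fromℕ n)))

-- The normalisation makes T 0 l equal to 1 / (3 (2l + 1)³).
T : ℕ → ℕ → ℚ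
T zero    l = inv 2 * inv (2 ℕ.* l) ³
T (suc n) l = fromℕ 32 * (fromℕ n + 1ℚ) ² * (fromℕ l + fromℕ n + 1ℚ) * (inv (2 ℕ.* suc (n ℕ.+ l)) ³ * T n l)

-- For the term T (suc n) l, with k = n + 1 + l + 1/2 and m = - l - 1/2, K = 2k and J = - 2m;
-- T-K and T-J are the recurrence of w applied to the factor w k and to the factor w m.
K : ℚ → ℚ → ℚ
K x y = fromℕ 2 * (x + y) + fromℕ 3

J : ℚ → ℚ
J x = fromℕ 2 * x + 1ℚ

:K : ∀ {n} → Polynomial n → Polynomial n → Polynomial n
:K x y = c 2 :* (x :+ y) :+ c 3

:J : ∀ {n} → Polynomial n → Polynomial n
:J x = c 2 :* x :+ c 1

J-inv : ∀ l → J (fromℕ l) * inv (2 ℕ.* l) ≡ 1ℚ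
J-inv l = trans (cong (_* inv (2 ℕ.* l)) (sym (fromℕ-odd l))) (fromℕ-inv (2 ℕ.* l))

K-inv : ∀ n l → K (fromℕ l) (fromℕ n) * inv (2 ℕ.* suc (n ℕ.+ l)) ≡ 1ℚ
K-inv n l = trans (cong (_* inv (2 ℕ.* suc (n ℕ.+ l))) (sym (fromℕ-odd₂ n l))) (fromℕ-inv (2 ℕ.* suc (n ℕ.+ l)))

T-zero : ∀ l → fromℕ 3 * J (fromℕ l) ³ * T 0 l ≡ 1ℚ
T-zero l = begin
  fromℕ 3 * J x ³ * (inv 2 * i ³)
    ≡⟨ solve 3 (λ t j i → c 3 :* j :³ :* (t :* i :³) := c 3 :* t :* (j :* i) :³) refl (inv 2) (J x) i ⟩
  fromℕ 3 * inv 2 * (J x * i) ³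
    ≡⟨ cong (λ z → fromℕ 3 * inv 2 * z ³) (J-inv l) ⟩
  1ℚ ∎
  where
  open ≡-Reasoning
  x = fromℕ l
  i = inv (2 ℕ.* l)

-- With k = K/2 the ratio w k / w (k - 1) = 2 (2k - 1) / k³ becomes 32 (l + n + 1) / K³; the square
-- of n + 1 comes from the factor n!². Here the denominator is cleared.
T-K : ∀ n l → K (fromℕ l) (fromℕ n) ³ * T (suc n) l
            ≡ fromℕ 32 * (fromℕ n + 1ℚ) ² * (fromℕ l + fromℕ n + 1ℚ) * T n l
T-K n l = begin
  k ³ * (a * (i ³ * T n l))
    ≡⟨ solve 4 (λ k i a t → k :³ :* (a :* (i :³ :* t)) := (k :* i) :³ :* (a :* t)) refl k i a (T n l) ⟩
  (k * i) ³ * (a * T n l)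
    ≡⟨ cong (λ z → z ³ * (a * T n l)) (K-inv n l) ⟩
  1ℚ * (a * T n l)
    ≡⟨ ℚ.*-identityˡ (a * T n l) ⟩
  a * T n l ∎
  where
  open ≡-Reasoning
  k = K (fromℕ l) (fromℕ n)
  i = inv (2 ℕ.* suc (n ℕ.+ l))
  a = fromℕ 32 * (fromℕ n + 1ℚ) ² * (fromℕ l + fromℕ n + 1ℚ)

T-J : ∀ n l → J (fromℕ l) ³ * T (suc n) l
            ≡ fromℕ 32 * (fromℕ n + 1ℚ) ² * (fromℕ l + 1ℚ) * T n (suc l)
T-J zero l = begin
  J x ³ * (fromℕ 32 * 1ℚ ² * (x + 0ℚ + 1ℚ) * (i₁ ³ * (inv 2 * i ³)))
    ≡⟨ solve 5 (λ j x i₁ i t → j :³ :* (c 32 :* c 1 :² :* (x :+ c 0 :+ c 1) :* (i₁ :³ :* (t :* i :³)))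
         := (j :* i) :³ :* (c 32 :* c 1 :² :* (x :+ c 1) :* (t :* i₁ :³))) refl (J x) x i₁ i (inv 2) ⟩
  (J x * i) ³ * (fromℕ 32 * 1ℚ ² * (x + 1ℚ) * (inv 2 * i₁ ³))
    ≡⟨ cong (λ z → z ³ * (fromℕ 32 * 1ℚ ² * (x + 1ℚ) * (inv 2 * i₁ ³))) (J-inv l) ⟩
  1ℚ * (fromℕ 32 * 1ℚ ² * (x + 1ℚ) * (inv 2 * i₁ ³))
    ≡⟨ ℚ.*-identityˡ (fromℕ 32 * 1ℚ ² * (x + 1ℚ) * (inv 2 * i₁ ³)) ⟩
  fromℕ 32 * 1ℚ ² * (x + 1ℚ) * (inv 2 * i₁ ³) ∎
  where
  open ≡-Reasoning
  x = fromℕ l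
  i = inv (2 ℕ.* l)
  i₁ = inv (2 ℕ.* suc l)
T-J (suc n) l = begin
  J x ³ * (fromℕ 32 * (y₁ + 1ℚ) ² * (x + y₁ + 1ℚ) * (i ³ * T (suc n) l))
    ≡⟨ solve 5 (λ x y₁ j i t → j :³ :* (c 32 :* (y₁ :+ c 1) :² :* (x :+ y₁ :+ c 1) :* (i :³ :* t))
         := c 32 :* (y₁ :+ c 1) :² :* (x :+ y₁ :+ c 1) :* (i :³ :* (j :³ :* t))) refl x y₁ (J x) i (T (suc n) l) ⟩
  fromℕ 32 * (y₁ + 1ℚ) ² * (x + y₁ + 1ℚ) * (i ³ * (J x ³ * T (suc n) l))
    ≡⟨ cong (λ z → fromℕ 32 * (y₁ + 1ℚ) ² * (x + y₁ + 1ℚ) * (i ³ * z)) (T-J n l) ⟩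
  fromℕ 32 * (y₁ + 1ℚ) ² * (x + y₁ + 1ℚ) * (i ³ * (fromℕ 32 * (y + 1ℚ) ² * (x + 1ℚ) * t))
    ≡⟨ cong (λ z → fromℕ 32 * (y₁ + 1ℚ) ² * z * (i ³ * (fromℕ 32 * (y + 1ℚ) ² * (x + 1ℚ) * t))) move ⟩
  fromℕ 32 * (y₁ + 1ℚ) ² * (fromℕ (suc l) + y + 1ℚ) * (i ³ * (fromℕ 32 * (y + 1ℚ) ² * (x + 1ℚ) * t))
    ≡⟨ solve 6 (λ x x₁ y y₁ i t →
         c 32 :* (y₁ :+ c 1) :² :* (x₁ :+ y :+ c 1) :* (i :³ :* (c 32 :* (y :+ c 1) :² :* (x :+ c 1) :* t))
         := c 32 :* (y₁ :+ c 1) :² :* (x :+ c 1) :* (c 32 :* (y :+ c 1) :² :* (x₁ :+ y :+ c 1) :* (i :³ :* t)))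
         refl x (fromℕ (suc l)) y y₁ i t ⟩
  fromℕ 32 * (y₁ + 1ℚ) ² * (x + 1ℚ) * (fromℕ 32 * (y + 1ℚ) ² * (fromℕ (suc l) + y + 1ℚ) * (i ³ * t))
    ≡⟨ cong (λ j → fromℕ 32 * (y₁ + 1ℚ) ² * (x + 1ℚ)
         -- The reciprocal depends on n and l through their sum only, so the same one serves for (n
         -- + 1, l) and (n, l + 1).
         * (fromℕ 32 * (y + 1ℚ) ² * (fromℕ (suc l) + y + 1ℚ) * (inv (2 ℕ.* suc j) ³ * t))) (ℕ.+-suc n l) ⟨
  fromℕ 32 * (y₁ + 1ℚ) ² * (x + 1ℚ) * T (suc n) (suc l) ∎
  where
  open ≡-Reasoning
  x = fromℕ l
  y = fromℕ n
  y₁ = fromℕ (suc n)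
  i = inv (2 ℕ.* suc (suc n ℕ.+ l))
  t = T n (suc l)
  move : x + y₁ + 1ℚ ≡ fromℕ (suc l) + y + 1ℚ
  move = trans (cong (λ z → x + z + 1ℚ) (fromℕ-suc n)) (trans
    (solve 2 (λ x y → x :+ (y :+ c 1) :+ c 1 := x :+ c 1 :+ y :+ c 1) refl x y)
    (cong (λ z → z + y + 1ℚ) (sym (fromℕ-suc l))))

-- From (K - J)⁵ = K³ (K² - 5KJ + 10J²) - J³ (10K² - 5KJ + J²) with K - J = 2 (n + 1).
T-step : ∀ n l → let x = fromℕ l ; y = fromℕ n in
  (y + 1ℚ) ³ * T (suc n) l
    ≡ (x + y + 1ℚ) * (K x y ² - fromℕ 5 * K x y * J x + fromℕ 10 * J x ²) * T n l
      - (x + 1ℚ) * (fromℕ 10 * K x y ² - fromℕ 5 * K x y * J x + J x ²) * T n (suc l)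
T-step n l = *-cancelˡ-≡ 31 (*-cancelˡ-≡ n (*-cancelˡ-≡ n (subst (λ s → s * (s * (fromℕ 32 * ((y + 1ℚ) ³ * t₁)))
    ≡ s * (s * (fromℕ 32 * ((x + y + 1ℚ) * q₁ * t - (x + 1ℚ) * q₂ * t′)))) (sym (fromℕ-suc n)) scaled)))
  where
  open ≡-Reasoning
  x = fromℕ l
  y = fromℕ n
  t = T n l
  t₁ = T (suc n) l
  t′ = T n (suc l)
  q₁ = K x y ² - fromℕ 5 * K x y * J x + fromℕ 10 * J x ²
  q₂ = fromℕ 10 * K x y ² - fromℕ 5 * K x y * J x + J x ²
  scaled : (y + 1ℚ) * ((y + 1ℚ) * (fromℕ 32 * ((y + 1ℚ) ³ * t₁)))
    ≡ (y + 1ℚ) * ((y + 1ℚ) * (fromℕ 32 * ((x + y + 1ℚ) * q₁ * t - (x + 1ℚ) * q₂ * t′)))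
  scaled = begin
    (y + 1ℚ) * ((y + 1ℚ) * (fromℕ 32 * ((y + 1ℚ) ³ * t₁)))
      ≡⟨ solve 3 (λ x y t₁ → let k = :K x y ; j = :J x in
           (y :+ c 1) :* ((y :+ c 1) :* (c 32 :* ((y :+ c 1) :³ :* t₁)))
           := (k :² :- c 5 :* k :* j :+ c 10 :* j :²) :* (k :³ :* t₁)
              :- (c 10 :* k :² :- c 5 :* k :* j :+ j :²) :* (j :³ :* t₁)) refl x y t₁ ⟩
    q₁ * (K x y ³ * t₁) - q₂ * (J x ³ * t₁)
      ≡⟨ cong₂ (λ a b → q₁ * a - q₂ * b) (T-K n l) (T-J n l) ⟩
    q₁ * (fromℕ 32 * (y + 1ℚ) ² * (x + y + 1ℚ) * t) - q₂ * (fromℕ 32 * (y + 1ℚ) ² * (x + 1ℚ) * t′)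
      ≡⟨ solve 6 (λ x y q₁ q₂ t t′ →
           q₁ :* (c 32 :* (y :+ c 1) :² :* (x :+ y :+ c 1) :* t) :- q₂ :* (c 32 :* (y :+ c 1) :² :* (x :+ c 1) :* t′)
           := (y :+ c 1) :* ((y :+ c 1) :* (c 32 :* ((x :+ y :+ c 1) :* q₁ :* t :- (x :+ c 1) :* q₂ :* t′))))
           refl x y q₁ q₂ t t′ ⟩
    (y + 1ℚ) * ((y + 1ℚ) * (fromℕ 32 * ((x + y + 1ℚ) * q₁ * t - (x + 1ℚ) * q₂ * t′))) ∎

-- 10K² - 5KJ + J² with l replaced by l - 1, the coefficient that T-step leaves at T (suc n) l after
-- the shift of summation index.
q : ℚ → ℚ → ℚ
q x y = fromℕ 24 * x ² + fromℕ 96 * x + fromℕ 60 * x * y + fromℕ 40 * y ² + fromℕ 130 * y + fromℕ 106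

:q : ∀ {n} → Polynomial n → Polynomial n → Polynomial n
:q x y = c 24 :* x :² :+ c 96 :* x :+ c 60 :* x :* y :+ c 40 :* y :² :+ c 130 :* y :+ c 106

:P : ∀ {n} → Polynomial n → Polynomial n
:P x = c 2 :* (c 2 :* x :+ c 1) :* (c 5 :* x :² :+ c 5 :* x :+ c 2)

-- The telescoping certificate: its difference in l is the error with which a single term satisfies
-- the recurrence.
U : ℕ → ℕ → ℚ
U n l = fromℕ 64 * (fromℕ n + 1ℚ) ² * fromℕ l * T n l - fromℕ l * q (fromℕ l) (fromℕ n) * T (suc n) l

-- `T-step` leaves -2K³ + 2J³, which is -16 (k³ + m³) again. `T-K` and `T-J` bring it down one
-- level, and everything outside the recurrence is a difference in l.
T-recurrence : ∀ n l → fromℕ (suc (suc n)) ³ * T (suc (suc n)) l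
  ≡ P (fromℕ (suc n)) * T (suc n) l - fromℕ 64 * fromℕ (suc n) ³ * T n l + (U n (suc l) - U n l)
T-recurrence n l = begin
  fromℕ (suc (suc n)) ³ * T (suc (suc n)) l
    ≡⟨ cong (λ z → z ³ * T (suc (suc n)) l) (fromℕ-suc (suc n)) ⟩
  (fromℕ (suc n) + 1ℚ) ³ * T (suc (suc n)) l
    ≡⟨ T-step (suc n) l ⟩
  rhs (fromℕ (suc n))
    ≡⟨ cong rhs (fromℕ-suc n) ⟩
  rhs (y + 1ℚ)
    ≡⟨ solve 4 (λ x y t₁ t₁′ → let k = :K x (y :+ c 1) ; j = :J x in
         (x :+ (y :+ c 1) :+ c 1) :* (k :² :- c 5 :* k :* j :+ c 10 :* j :²) :* t₁
           :- (x :+ c 1) :* (c 10 :* k :² :- c 5 :* k :* j :+ j :²) :* t₁′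
         := :P (y :+ c 1) :* t₁ :- c 2 :* (:K x y :³ :* t₁) :+ c 2 :* (:J x :³ :* t₁)
           :+ x :* :q x y :* t₁ :- (x :+ c 1) :* :q (x :+ c 1) y :* t₁′) refl x y t₁ t₁′ ⟩
  P (y + 1ℚ) * t₁ - fromℕ 2 * (K x y ³ * t₁) + fromℕ 2 * (J x ³ * t₁)
    + x * q x y * t₁ - (x + 1ℚ) * q (x + 1ℚ) y * t₁′
    ≡⟨ cong₂ (λ a b → P (y + 1ℚ) * t₁ - fromℕ 2 * a + fromℕ 2 * b
         + x * q x y * t₁ - (x + 1ℚ) * q (x + 1ℚ) y * t₁′) (T-K n l) (T-J n l) ⟩
  P (y + 1ℚ) * t₁ - fromℕ 2 * (fromℕ 32 * (y + 1ℚ) ² * (x + y + 1ℚ) * t)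
    + fromℕ 2 * (fromℕ 32 * (y + 1ℚ) ² * (x + 1ℚ) * t′)
    + x * q x y * t₁ - (x + 1ℚ) * q (x + 1ℚ) y * t₁′
    ≡⟨ solve 7 (λ x y p q q′ t t′ → let s = y :+ c 1 in
          p :- c 2 :* (c 32 :* s :² :* (x :+ y :+ c 1) :* t) :+ c 2 :* (c 32 :* s :² :* (x :+ c 1) :* t′) :+ q :- q′
          := p :- c 64 :* s :³ :* t :+ ((c 64 :* s :² :* (x :+ c 1) :* t′ :- q′) :- (c 64 :* s :² :* x :* t :- q)))
          refl x y (P (y + 1ℚ) * t₁) (x * q x y * t₁) ((x + 1ℚ) * q (x + 1ℚ) y * t₁′) t t′ ⟩
  P (y + 1ℚ) * t₁ - fromℕ 64 * (y + 1ℚ) ³ * t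
    + ((fromℕ 64 * (y + 1ℚ) ² * (x + 1ℚ) * t′ - (x + 1ℚ) * q (x + 1ℚ) y * t₁′) - U n l)
    ≡⟨ cong₂ (λ s x′ → P s * t₁ - fromℕ 64 * s ³ * t
         + ((fromℕ 64 * (y + 1ℚ) ² * x′ * t′ - x′ * q x′ y * t₁′) - U n l)) (fromℕ-suc n) (fromℕ-suc l) ⟨
  P (fromℕ (suc n)) * t₁ - fromℕ 64 * fromℕ (suc n) ³ * t + (U n (suc l) - U n l) ∎
  where
  open ≡-Reasoning
  x = fromℕ l
  y = fromℕ n
  t = T n l
  t₁ = T (suc n) l
  t′ = T n (suc l)
  t₁′ = T (suc n) (suc l)
  rhs : ℚ → ℚ
  rhs y = (x + y + 1ℚ) * (K x y ² - fromℕ 5 * K x y * J x + fromℕ 10 * J x ²) * t₁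
      - (x + 1ℚ) * (fromℕ 10 * K x y ² - fromℕ 5 * K x y * J x + J x ²) * t₁′

R : ℕ → ℕ → ℚ
R n zero    = 0ℚ
R n (suc N) = R n N + T n N

-- Summing over l < N telescopes to the upper end alone, since `U n 0` vanishes through its factor
-- l.
R-recurrence : ∀ n N → fromℕ (suc (suc n)) ³ * R (suc (suc n)) N
  ≡ P (fromℕ (suc n)) * R (suc n) N - fromℕ 64 * fromℕ (suc n) ³ * R n N + U n N
R-recurrence n zero = solve 7 (λ a p b s t q t₁ →
    a :* c 0 := p :* c 0 :- b :* c 0 :+ (c 64 :* s :* c 0 :* t :- c 0 :* q :* t₁)) refl
  (fromℕ (suc (suc n)) ³) (P (fromℕ (suc n))) (fromℕ 64 * fromℕ (suc n) ³) ((fromℕ n + 1ℚ) ²)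
  (T n 0) (q 0ℚ (fromℕ n)) (T (suc n) 0)
R-recurrence n (suc N) = begin
  a * (R (suc (suc n)) N + T (suc (suc n)) N)
    ≡⟨ ℚ.*-distribˡ-+ a (R (suc (suc n)) N) (T (suc (suc n)) N) ⟩
  a * R (suc (suc n)) N + a * T (suc (suc n)) N
    ≡⟨ cong₂ _+_ (R-recurrence n N) (T-recurrence n N) ⟩
  (p * R (suc n) N - b * R n N + U n N) + (p * T (suc n) N - b * T n N + (U n (suc N) - U n N))
    ≡⟨ solve 8 (λ p b r₁ r t₁ t u u′ →
         (p :* r₁ :- b :* r :+ u) :+ (p :* t₁ :- b :* t :+ (u′ :- u)) := p :* (r₁ :+ t₁) :- b :* (r :+ t) :+ u′)
         refl p b (R (suc n) N) (R n N) (T (suc n) N) (T n N) (U n N) (U n (suc N)) ⟩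
  p * (R (suc n) N + T (suc n) N) - b * (R n N + T n N) + U n (suc N) ∎
  where
  open ≡-Reasoning
  a = fromℕ (suc (suc n)) ³
  p = P (fromℕ (suc n))
  b = fromℕ 64 * fromℕ (suc n) ³

-- The boundary term at infinity is 1, not 0: this is where the inhomogeneity B₁ = 1 comes from.
R-one : ∀ N → R 1 N + 1ℚ ≡ fromℕ 4 * R 0 N + (fromℕ 2 * fromℕ N + fromℕ 3) * T 0 N
R-one zero = refl
R-one (suc N) = begin
  (R 1 N + T 1 N) + 1ℚ
    ≡⟨ solve 2 (λ r t → (r :+ t) :+ c 1 := (r :+ c 1) :+ c 1 :* t) refl (R 1 N) (T 1 N) ⟩
  (R 1 N + 1ℚ) + 1ℚ * T 1 N
    ≡⟨ cong₂ _+_ (R-one N) (T-step 0 N) ⟩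
  (fromℕ 4 * R 0 N + (fromℕ 2 * x + fromℕ 3) * t)
    + ((x + 0ℚ + 1ℚ) * (K x 0ℚ ² - fromℕ 5 * K x 0ℚ * J x + fromℕ 10 * J x ²) * t
      - (x + 1ℚ) * (fromℕ 10 * K x 0ℚ ² - fromℕ 5 * K x 0ℚ * J x + J x ²) * t′)
    ≡⟨ solve 4 (λ x r t t′ → let k = :K x (c 0) ; j = :J x ; j′ = :J (x :+ c 1) in
         (c 4 :* r :+ (c 2 :* x :+ c 3) :* t) :+ ((x :+ c 0 :+ c 1) :* (k :² :- c 5 :* k :* j :+ c 10 :* j :²) :* t
           :- (x :+ c 1) :* (c 10 :* k :² :- c 5 :* k :* j :+ j :²) :* t′)
         := c 4 :* (r :+ t) :+ (c 2 :* (x :+ c 1) :+ c 3) :* t′ :+ (c 3 :* j :³ :* t :- c 3 :* j′ :³ :* t′))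
         refl x (R 0 N) t t′ ⟩
  fromℕ 4 * (R 0 N + t) + (fromℕ 2 * (x + 1ℚ) + fromℕ 3) * t′ + (fromℕ 3 * J x ³ * t - fromℕ 3 * J (x + 1ℚ) ³ * t′)
    ≡⟨ cong (λ z → fromℕ 4 * (R 0 N + t) + (fromℕ 2 * z + fromℕ 3) * t′ + (fromℕ 3 * J x ³ * t - fromℕ 3 * J z ³ * t′))
         (fromℕ-suc N) ⟨
  fromℕ 4 * (R 0 N + t) + (fromℕ 2 * x′ + fromℕ 3) * t′ + (fromℕ 3 * J x ³ * t - fromℕ 3 * J x′ ³ * t′)
    -- By `T-zero` both terms of the remaining difference equal 1.
    ≡⟨ cong₂ (λ a b → fromℕ 4 * (R 0 N + t) + (fromℕ 2 * x′ + fromℕ 3) * t′ + (a - b)) (T-zero N) (T-zero (suc N)) ⟩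
  fromℕ 4 * (R 0 N + t) + (fromℕ 2 * x′ + fromℕ 3) * t′ + 0ℚ
    ≡⟨ ℚ.+-identityʳ (fromℕ 4 * (R 0 N + t) + (fromℕ 2 * x′ + fromℕ 3) * t′) ⟩
  fromℕ 4 * (R 0 N + t) + (fromℕ 2 * x′ + fromℕ 3) * t′ ∎
  where
  open ≡-Reasoning
  x = fromℕ N
  x′ = fromℕ (suc N)
  t = T 0 N
  t′ = T 0 (suc N)

-- Positivity and size of the half-integer terms

0≤T : ∀ n l → 0ℚ ≤ T n l
0≤T zero    l = 0≤inv 2 ⊗ (0≤inv (2 ℕ.* l) ⊗ 0≤inv (2 ℕ.* l) ⊗ 0≤inv (2 ℕ.* l))
0≤T (suc n) l = 0≤fromℕ 32 ⊗ (s ⊗ s) ⊗ (0≤fromℕ l ⊕ 0≤fromℕ n ⊕ 0≤fromℕ 1) ⊗ (i ⊗ i ⊗ i ⊗ 0≤T n l)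
  where
  s = 0≤fromℕ n ⊕ 0≤fromℕ 1
  i = 0≤inv (2 ℕ.* suc (n ℕ.+ l))

K-cancel : ∀ n l {a b} → K (fromℕ l) (fromℕ n) * a ≤ K (fromℕ l) (fromℕ n) * b → a ≤ b
K-cancel n l {a} {b} le = *-cancelˡ-≤ (2 ℕ.* suc (n ℕ.+ l)) (subst (λ z → z * a ≤ z * b) (sym (fromℕ-odd₂ n l)) le)

-- By `T-K` this amounts to 32 (n + 1)² (l + n + 1) ≤ 4K³, and the difference has nonnegative
-- coefficients in l and n.
T-suc-≤ : ∀ n l → T (suc n) l ≤ fromℕ 4 * T n l
T-suc-≤ n l = K-cancel n l (K-cancel n l (K-cancel n l (≤-excess
  ((0≤fromℕ 144 ⊗ (x ⊗ x) ⊕ 0≤fromℕ 32 ⊗ (x ⊗ x ⊗ x) ⊕ 0≤fromℕ 96 ⊗ (x ⊗ x) ⊗ y ⊕ 0≤fromℕ 64 ⊗ x ⊗ (y ⊗ y)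
    ⊕ 0≤fromℕ 224 ⊗ x ⊗ y ⊕ 0≤fromℕ 184 ⊗ x ⊕ 0≤fromℕ 48 ⊗ (y ⊗ y) ⊕ 0≤fromℕ 120 ⊗ y ⊕ 0≤fromℕ 76) ⊗ 0≤T n l)
  (trans (cong (_+ e * T n l)
      (trans (solve 2 (λ k t → k :* (k :* (k :* t)) := k :³ :* t) refl k (T (suc n) l)) (T-K n l)))
    (solve 3 (λ x y t → c 32 :* (y :+ c 1) :² :* (x :+ y :+ c 1) :* t
        :+ (c 144 :* x :² :+ c 32 :* x :³ :+ c 96 :* x :² :* y :+ c 64 :* x :* y :²
          :+ c 224 :* x :* y :+ c 184 :* x :+ c 48 :* y :² :+ c 120 :* y :+ c 76) :* t
      := :K x y :* (:K x y :* (:K x y :* (c 4 :* t)))) refl (fromℕ l) (fromℕ n) (T n l))))))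
  where
  x = 0≤fromℕ l
  y = 0≤fromℕ n
  k = K (fromℕ l) (fromℕ n)
  e = let x = fromℕ l ; y = fromℕ n in fromℕ 144 * x ² + fromℕ 32 * x ³ + fromℕ 96 * x ² * y + fromℕ 64 * x * y ²
          + fromℕ 224 * x * y + fromℕ 184 * x + fromℕ 48 * y ² + fromℕ 120 * y + fromℕ 76

fromℕ-^ : ∀ b n → fromℕ (b ℕ.^ suc n) ≡ fromℕ b * fromℕ (b ℕ.^ n)
fromℕ-^ b n = fromℕ-* b (b ℕ.^ n)

T-≤ : ∀ n l → T n l ≤ fromℕ (4 ℕ.^ n) * T 0 l
T-≤ zero    l = ℚ.≤-reflexive (sym (ℚ.*-identityˡ (T 0 l)))
T-≤ (suc n) l = begin
  T (suc n) l                             ≤⟨ T-suc-≤ n l ⟩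
  fromℕ 4 * T n l                         ≤⟨ *-monoˡ (0≤fromℕ 4) (T-≤ n l) ⟩
  fromℕ 4 * (fromℕ (4 ℕ.^ n) * T 0 l)     ≡⟨ ℚ.*-assoc (fromℕ 4) (fromℕ (4 ℕ.^ n)) (T 0 l) ⟨
  fromℕ 4 * fromℕ (4 ℕ.^ n) * T 0 l       ≡⟨ cong (_* T 0 l) (fromℕ-^ 4 n) ⟨
  fromℕ (4 ℕ.^ suc n) * T 0 l             ∎
  where open ℚ.≤-Reasoning

0≤R : ∀ n N → 0ℚ ≤ R n N
0≤R n zero    = ℚ.≤-refl
0≤R n (suc N) = 0≤R n N ⊕ 0≤T n N

R-≤ : ∀ n N → R n N ≤ fromℕ (4 ℕ.^ n) * R 0 N
R-≤ n zero    = ℚ.≤-reflexive (sym (ℚ.*-zeroʳ (fromℕ (4 ℕ.^ n))))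
R-≤ n (suc N) = subst (R n (suc N) ≤_) (sym (ℚ.*-distribˡ-+ (fromℕ (4 ℕ.^ n)) (R 0 N) (T 0 N)))
  (ℚ.+-mono-≤ (R-≤ n N) (T-≤ n N))

-- The decay is cubic, but a quadratic bound suffices for O(1/N), and with these two factors it
-- telescopes.
T-zero-≤ : ∀ N → (fromℕ N + fromℕ 2) * (fromℕ N + 1ℚ) * T 0 N ≤ 1ℚ
T-zero-≤ N = ≤-excess
  ((0≤fromℕ 24 ⊗ (x ⊗ x ⊗ x) ⊕ 0≤fromℕ 35 ⊗ (x ⊗ x) ⊕ 0≤fromℕ 15 ⊗ x ⊕ 0≤fromℕ 1) ⊗ 0≤T 0 N)
  (trans (solve 2 (λ x t → (x :+ c 2) :* (x :+ c 1) :* t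
      :+ (c 24 :* x :³ :+ c 35 :* x :² :+ c 15 :* x :+ c 1) :* t := c 3 :* :J x :³ :* t) refl (fromℕ N) (T 0 N)) (T-zero N))
  where
  x = 0≤fromℕ N

-- Telescoping with 1/((N + 1)(N + 2)) = 1/(N + 1) - 1/(N + 2). Keeping `inv N` on the left is what
-- lets the induction close.
R₀-≤ : ∀ N → R 0 N + inv N ≤ 1ℚ
R₀-≤ zero    = ℚ.≤-refl
R₀-≤ (suc N) = ℚ.≤-trans (subst (_≤ R 0 N + inv N) (sym (ℚ.+-assoc (R 0 N) (T 0 N) (inv (suc N))))
    (ℚ.+-monoʳ-≤ (R 0 N) step)) (R₀-≤ N)
  where
  open ℚ.≤-Reasoning
  i = inv N
  j = inv (suc N)
  step : T 0 N + inv (suc N) ≤ inv N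
  step = *-cancelˡ-≤ (suc N) (*-cancelˡ-≤ N (begin
    fromℕ (suc N) * (fromℕ (suc (suc N)) * (T 0 N + j))
      ≡⟨ solve 4 (λ s₁ s₂ t j → s₁ :* (s₂ :* (t :+ j)) := s₂ :* s₁ :* t :+ s₁ :* (s₂ :* j)) refl
           (fromℕ (suc N)) (fromℕ (suc (suc N))) (T 0 N) j ⟩
    fromℕ (suc (suc N)) * fromℕ (suc N) * T 0 N + fromℕ (suc N) * (fromℕ (suc (suc N)) * j)
      ≡⟨ cong₂ (λ s₂ s₁ → s₂ * s₁ * T 0 N + fromℕ (suc N) * (fromℕ (suc (suc N)) * j)) (fromℕ-suc² N) (fromℕ-suc N) ⟩
    (fromℕ N + fromℕ 2) * (fromℕ N + 1ℚ) * T 0 N + fromℕ (suc N) * (fromℕ (suc (suc N)) * j)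
      ≤⟨ ℚ.+-monoˡ-≤ (fromℕ (suc N) * (fromℕ (suc (suc N)) * j)) (T-zero-≤ N) ⟩
    1ℚ + fromℕ (suc N) * (fromℕ (suc (suc N)) * j)
      ≡⟨ cong₂ (λ s₁ z → 1ℚ + s₁ * z) (fromℕ-suc N) (fromℕ-inv (suc N)) ⟩
    1ℚ + (fromℕ N + 1ℚ) * 1ℚ
      ≡⟨ solve 1 (λ x → c 1 :+ (x :+ c 1) :* c 1 := (x :+ c 2) :* c 1) refl (fromℕ N) ⟩
    (fromℕ N + fromℕ 2) * 1ℚ
      ≡⟨ cong₂ _*_ (fromℕ-suc² N) (fromℕ-inv N) ⟨
    fromℕ (suc (suc N)) * (fromℕ (suc N) * i)
      ≡⟨ solve 3 (λ s₁ s₂ i → s₂ :* (s₁ :* i) := s₁ :* (s₂ :* i)) refl (fromℕ (suc N)) (fromℕ (suc (suc N))) i ⟩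
    fromℕ (suc N) * (fromℕ (suc (suc N)) * i) ∎))

-- q ≤ 12K² coefficientwise, and `T-K` turns K³ `T (suc n) l` into a multiple of l + n + 1 ≤ K/2. So
-- the quadratic growth of q in l is absorbed.
q-≤ : ∀ n l → q (fromℕ l) (fromℕ n) * T (suc n) l ≤ fromℕ 192 * (fromℕ n + 1ℚ) ² * T n l
q-≤ n l = K-cancel n l (≤-excess
  ((0≤fromℕ 24 ⊗ (0≤x ⊗ 0≤x) ⊕ 0≤fromℕ 36 ⊗ 0≤x ⊗ 0≤y ⊕ 0≤fromℕ 8 ⊗ (0≤y ⊗ 0≤y)
        ⊕ 0≤fromℕ 48 ⊗ 0≤x ⊕ 0≤fromℕ 14 ⊗ 0≤y ⊕ 0≤fromℕ 2)
      ⊗ (0≤fromℕ 2 ⊗ (0≤x ⊕ 0≤y) ⊕ 0≤fromℕ 3) ⊗ 0≤T (suc n) l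
    ⊕ 0≤fromℕ 192 ⊗ ((0≤y ⊕ 0≤fromℕ 1) ⊗ (0≤y ⊕ 0≤fromℕ 1)) ⊗ 0≤T n l)
  (begin
    K x y * (q x y * t₁) + ((fromℕ 24 * x ² + fromℕ 36 * x * y + fromℕ 8 * y ² + fromℕ 48 * x + fromℕ 14 * y + fromℕ 2)
      * K x y * t₁ + fromℕ 192 * (y + 1ℚ) ² * t)
      ≡⟨ solve 4 (λ x y t t₁ → :K x y :* (:q x y :* t₁)
           :+ ((c 24 :* x :² :+ c 36 :* x :* y :+ c 8 :* y :² :+ c 48 :* x :+ c 14 :* y :+ c 2) :* :K x y :* t₁
             :+ c 192 :* (y :+ c 1) :² :* t)
           := c 12 :* (:K x y :³ :* t₁) :+ c 192 :* (y :+ c 1) :² :* t) refl x y t t₁ ⟩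
    fromℕ 12 * (K x y ³ * t₁) + fromℕ 192 * (y + 1ℚ) ² * t
      ≡⟨ cong (λ z → fromℕ 12 * z + fromℕ 192 * (y + 1ℚ) ² * t) (T-K n l) ⟩
    fromℕ 12 * (fromℕ 32 * (y + 1ℚ) ² * (x + y + 1ℚ) * t) + fromℕ 192 * (y + 1ℚ) ² * t
      ≡⟨ solve 3 (λ x y t → c 12 :* (c 32 :* (y :+ c 1) :² :* (x :+ y :+ c 1) :* t) :+ c 192 :* (y :+ c 1) :² :* t
           := :K x y :* (c 192 :* (y :+ c 1) :² :* t)) refl x y t ⟩
    K x y * (fromℕ 192 * (y + 1ℚ) ² * t) ∎))
  where
  open ≡-Reasoning
  x = fromℕ l
  y = fromℕ n
  t = T n l
  t₁ = T (suc n) l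
  0≤x = 0≤fromℕ l
  0≤y = 0≤fromℕ n

0≤q : ∀ n l → 0ℚ ≤ q (fromℕ l) (fromℕ n)
0≤q n l = 0≤fromℕ 24 ⊗ (x ⊗ x) ⊕ 0≤fromℕ 96 ⊗ x ⊕ 0≤fromℕ 60 ⊗ x ⊗ y
  ⊕ 0≤fromℕ 40 ⊗ (y ⊗ y) ⊕ 0≤fromℕ 130 ⊗ y ⊕ 0≤fromℕ 106
  where
  x = 0≤fromℕ l
  y = 0≤fromℕ n

-- Sequences that are O(1/N)

-- Null means O(1/N): with the rate built in, closure under sums and scaling is immediate.
Null : (ℕ → ℚ) → Set
Null a = ∃[ A ] (∀ N → fromℕ (suc N) * ∣ a N ∣ ≤ A)

Null-cong : ∀ {a b} → (∀ N → a N ≡ b N) → Null a → Null b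
Null-cong eq (A , h) = A , λ N → subst (λ z → fromℕ (suc N) * ∣ z ∣ ≤ A) (eq N) (h N)

Null-+ : ∀ {a b} → Null a → Null b → Null (λ N → a N + b N)
Null-+ {a} {b} (A , h) (A′ , h′) = A + A′ , λ N → begin
  fromℕ (suc N) * ∣ a N + b N ∣
    ≤⟨ *-monoˡ (0≤fromℕ (suc N)) (ℚ.∣p+q∣≤∣p∣+∣q∣ (a N) (b N)) ⟩
  fromℕ (suc N) * (∣ a N ∣ + ∣ b N ∣)
    ≡⟨ ℚ.*-distribˡ-+ (fromℕ (suc N)) ∣ a N ∣ ∣ b N ∣ ⟩
  fromℕ (suc N) * ∣ a N ∣ + fromℕ (suc N) * ∣ b N ∣
    ≤⟨ ℚ.+-mono-≤ (h N) (h′ N) ⟩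
  A + A′ ∎
  where open ℚ.≤-Reasoning

Null-* : ∀ k {a} → Null a → Null (λ N → k * a N)
Null-* k {a} (A , h) = ∣ k ∣ * A , λ N → begin
  fromℕ (suc N) * ∣ k * a N ∣
    ≡⟨ cong (fromℕ (suc N) *_) (ℚ.∣p*q∣≡∣p∣*∣q∣ k (a N)) ⟩
  fromℕ (suc N) * (∣ k ∣ * ∣ a N ∣)
    ≡⟨ solve 3 (λ s k a → s :* (k :* a) := k :* (s :* a)) refl (fromℕ (suc N)) ∣ k ∣ ∣ a N ∣ ⟩
  ∣ k ∣ * (fromℕ (suc N) * ∣ a N ∣)
    ≤⟨ *-monoˡ (ℚ.0≤∣p∣ k) (h N) ⟩
  ∣ k ∣ * A ∎
  where open ℚ.≤-Reasoning

Null-cancel : ∀ k {a} → Null (λ N → fromℕ (suc k) * a N) → Null a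
Null-cancel k {a} h = Null-cong (λ N → *-cancelˡ-≡ k (begin
  fromℕ (suc k) * (inv k * (fromℕ (suc k) * a N))
    ≡⟨ solve 3 (λ s i a → s :* (i :* (s :* a)) := s :* i :* (s :* a)) refl (fromℕ (suc k)) (inv k) (a N) ⟩
  fromℕ (suc k) * inv k * (fromℕ (suc k) * a N)
    ≡⟨ cong (_* (fromℕ (suc k) * a N)) (fromℕ-inv k) ⟩
  1ℚ * (fromℕ (suc k) * a N)
    ≡⟨ ℚ.*-identityˡ (fromℕ (suc k) * a N) ⟩
  fromℕ (suc k) * a N ∎)) (Null-* (inv k) h)
  where open ≡-Reasoning

-- By `q-≤` the boundary term is at most 64 + 192 = 256 times (n + 1)² l `T n l`, and `T n l` is
-- O(1/l²) by comparison with `T 0 l`.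
Null-U : ∀ n → Null (U n)
Null-U n = fromℕ 256 * s ² * fromℕ (4 ℕ.^ n) , λ l → begin
  fromℕ (suc l) * ∣ U n l ∣
    ≤⟨ *-monoˡ (0≤fromℕ (suc l)) (begin
      ∣ U n l ∣
        ≤⟨ ℚ.∣p-q∣≤∣p∣+∣q∣ (fromℕ 64 * s ² * fromℕ l * T n l) (fromℕ l * q (fromℕ l) (fromℕ n) * T (suc n) l) ⟩
      ∣ fromℕ 64 * s ² * fromℕ l * T n l ∣ + ∣ fromℕ l * q (fromℕ l) (fromℕ n) * T (suc n) l ∣
        ≡⟨ cong₂ _+_ (ℚ.0≤p⇒∣p∣≡p (0≤fromℕ 64 ⊗ (0≤s ⊗ 0≤s) ⊗ 0≤fromℕ l ⊗ 0≤T n l))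
             (ℚ.0≤p⇒∣p∣≡p (0≤fromℕ l ⊗ 0≤q n l ⊗ 0≤T (suc n) l)) ⟩
      fromℕ 64 * s ² * fromℕ l * T n l + fromℕ l * q (fromℕ l) (fromℕ n) * T (suc n) l
        ≡⟨ cong (_+_ (fromℕ 64 * s ² * fromℕ l * T n l)) (ℚ.*-assoc (fromℕ l) (q (fromℕ l) (fromℕ n)) (T (suc n) l)) ⟩
      fromℕ 64 * s ² * fromℕ l * T n l + fromℕ l * (q (fromℕ l) (fromℕ n) * T (suc n) l)
        ≤⟨ ℚ.+-monoʳ-≤ (fromℕ 64 * s ² * fromℕ l * T n l) (*-monoˡ (0≤fromℕ l) (q-≤ n l)) ⟩
      fromℕ 64 * s ² * fromℕ l * T n l + fromℕ l * (fromℕ 192 * s ² * T n l)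
        ≡⟨ solve 3 (λ s x t → c 64 :* s :² :* x :* t :+ x :* (c 192 :* s :² :* t) := c 256 :* s :² :* x :* t)
             refl s (fromℕ l) (T n l) ⟩
      fromℕ 256 * s ² * fromℕ l * T n l
        ≤⟨ *-monoˡ (0≤fromℕ 256 ⊗ (0≤s ⊗ 0≤s) ⊗ 0≤fromℕ l) (T-≤ n l) ⟩
      fromℕ 256 * s ² * fromℕ l * (fromℕ (4 ℕ.^ n) * T 0 l) ∎) ⟩
  fromℕ (suc l) * (fromℕ 256 * s ² * fromℕ l * (fromℕ (4 ℕ.^ n) * T 0 l))
    -- The factor l is enlarged to l + 2, which completes the product bounded in `T-zero-≤`.
    ≤⟨ ≤-excess (0≤fromℕ (suc l) ⊗ (0≤fromℕ 256 ⊗ (0≤s ⊗ 0≤s) ⊗ 0≤fromℕ 2 ⊗ (0≤fromℕ (4 ℕ.^ n) ⊗ 0≤T 0 l)))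
         (solve 5 (λ s₁ s x f t → s₁ :* (c 256 :* s :² :* x :* (f :* t)) :+ s₁ :* (c 256 :* s :² :* c 2 :* (f :* t))
           := c 256 :* s :² :* f :* ((x :+ c 2) :* s₁ :* t)) refl (fromℕ (suc l)) s (fromℕ l) (fromℕ (4 ℕ.^ n)) (T 0 l)) ⟩
  fromℕ 256 * s ² * fromℕ (4 ℕ.^ n) * ((fromℕ l + fromℕ 2) * fromℕ (suc l) * T 0 l)
    ≤⟨ *-monoˡ (0≤fromℕ 256 ⊗ (0≤s ⊗ 0≤s) ⊗ 0≤fromℕ (4 ℕ.^ n))
         (subst (λ z → (fromℕ l + fromℕ 2) * z * T 0 l ≤ 1ℚ) (sym (fromℕ-suc l)) (T-zero-≤ l)) ⟩
  fromℕ 256 * s ² * fromℕ (4 ℕ.^ n) * 1ℚ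
    ≡⟨ ℚ.*-identityʳ (fromℕ 256 * s ² * fromℕ (4 ℕ.^ n)) ⟩
  fromℕ 256 * s ² * fromℕ (4 ℕ.^ n) ∎
  where
  open ℚ.≤-Reasoning
  s = fromℕ n + 1ℚ
  0≤s = 0≤fromℕ n ⊕ 0≤fromℕ 1

Null-boundary : Null (λ N → (fromℕ 2 * fromℕ N + fromℕ 3) * T 0 N)
Null-boundary = fromℕ 2 , λ N → begin
  fromℕ (suc N) * ∣ (fromℕ 2 * fromℕ N + fromℕ 3) * T 0 N ∣
    ≡⟨ cong₂ _*_ (fromℕ-suc N) (ℚ.0≤p⇒∣p∣≡p ((0≤fromℕ 2 ⊗ 0≤fromℕ N ⊕ 0≤fromℕ 3) ⊗ 0≤T 0 N)) ⟩
  (fromℕ N + 1ℚ) * ((fromℕ 2 * fromℕ N + fromℕ 3) * T 0 N)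
    ≤⟨ ≤-excess ((0≤fromℕ N ⊕ 0≤fromℕ 1) ⊗ 0≤T 0 N)
         (solve 2 (λ x t → (x :+ c 1) :* ((c 2 :* x :+ c 3) :* t) :+ (x :+ c 1) :* t
           := c 2 :* ((x :+ c 2) :* (x :+ c 1) :* t)) refl (fromℕ N) (T 0 N)) ⟩
  fromℕ 2 * ((fromℕ N + fromℕ 2) * (fromℕ N + 1ℚ) * T 0 N)
    ≤⟨ *-monoˡ (0≤fromℕ 2) (T-zero-≤ N) ⟩
  fromℕ 2 ∎
  where open ℚ.≤-Reasoning

-- Growth of the Domb numbers

-- A lower bound on the ratio of consecutive Domb numbers that reproduces itself: in the recurrence
-- the induction hypothesis controls the subtracted term. It starts at `D 1`, since the analogue for
-- `D 0` and `D 1` would read 8 ≤ 4.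
D-suc-≥ : ∀ n → fromℕ 4 * (fromℕ n + fromℕ 3) * fromℕ (D (suc n)) ≤ (fromℕ n + fromℕ 2) * fromℕ (D (suc (suc n)))
-- 12 · 4 = 48 and 2 · 28 = 56.
D-suc-≥ zero    = *≤* (ℤ.+≤+ (ℕ.m≤m+n 48 8))
D-suc-≥ (suc n) = subst (λ z → fromℕ 4 * (z + fromℕ 3) * b ≤ (z + fromℕ 2) * a) (sym (fromℕ-suc n))
  (cancel (cancel (cancel (begin
  s * (s * (s * (fromℕ 4 * (y + 1ℚ + fromℕ 3) * b)))
    ≤⟨ ≤-excess ((0≤fromℕ 30 ⊗ (0≤y ⊗ 0≤y ⊗ 0≤y) ⊕ 0≤fromℕ 192 ⊗ (0≤y ⊗ 0≤y) ⊕ 0≤fromℕ 402 ⊗ 0≤y ⊕ 0≤fromℕ 272)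
          ⊗ 0≤fromℕ (D (suc (suc n))))
        (solve 2 (λ y b → let s = y :+ c 3 in s :* (s :* (s :* (c 4 :* (y :+ c 1 :+ c 3) :* b)))
           :+ (c 30 :* y :³ :+ c 192 :* y :² :+ c 402 :* y :+ c 272) :* b
           := s :* :P (y :+ c 2) :* b :- c 16 :* (y :+ c 2) :³ :* ((y :+ c 2) :* b)) refl y b) ⟩
  s * P (y + fromℕ 2) * b - fromℕ 16 * (y + fromℕ 2) ³ * ((y + fromℕ 2) * b)
    ≤⟨ ℚ.+-monoʳ-≤ (s * P (y + fromℕ 2) * b)
         (ℚ.neg-antimono-≤ (*-monoˡ (0≤fromℕ 16 ⊗ (0≤y₂ ⊗ 0≤y₂ ⊗ 0≤y₂)) (D-suc-≥ n))) ⟩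
  s * P (y + fromℕ 2) * b - fromℕ 16 * (y + fromℕ 2) ³ * (fromℕ 4 * s * e)
    ≡⟨ solve 5 (λ s p b y₂ e → s :* p :* b :- c 16 :* y₂ :³ :* (c 4 :* s :* e) := s :* (p :* b :- c 64 :* y₂ :³ :* e))
         refl s (P (y + fromℕ 2)) b (y + fromℕ 2) e ⟩
  s * (P (y + fromℕ 2) * b - fromℕ 64 * (y + fromℕ 2) ³ * e)
    ≡⟨ cong (λ z → s * (P z * b - fromℕ 64 * z ³ * e)) (fromℕ-suc² n) ⟨
  s * (P (fromℕ (suc (suc n))) * b - fromℕ 64 * fromℕ (suc (suc n)) ³ * e)
    ≡⟨ cong (s *_) (D-recurrence (suc n)) ⟨
  s * (fromℕ (suc (suc (suc n))) ³ * a)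
    ≡⟨ cong (λ z → s * (z ³ * a)) suc³ ⟩
  s * (s ³ * a)
    ≡⟨ solve 2 (λ y a → let s = y :+ c 3 in s :* (s :³ :* a) := s :* (s :* (s :* ((y :+ c 1 :+ c 2) :* a)))) refl y a ⟩
  s * (s * (s * ((y + 1ℚ + fromℕ 2) * a))) ∎))))
  where
  open ℚ.≤-Reasoning
  y = fromℕ n
  s = y + fromℕ 3
  a = fromℕ (D (suc (suc (suc n))))
  b = fromℕ (D (suc (suc n)))
  e = fromℕ (D (suc n))
  0≤y = 0≤fromℕ n
  0≤y₂ = 0≤y ⊕ 0≤fromℕ 2
  suc³ : fromℕ (suc (suc (suc n))) ≡ s
  suc³ = trans (cong fromℕ (ℕ.+-comm 3 n)) (fromℕ-+ n 3)
  cancel : ∀ {u v} → s * u ≤ s * v → u ≤ v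
  cancel {u} {v} le = *-cancelˡ-≤ (suc (suc n)) (subst (λ z → z * u ≤ z * v) (sym suc³) le)

-- `D-suc-≥` says that the quotient of the two sides is monotone, and at n = 0 both are 8. The
-- linear factor beyond the power of 4 is what outgrows `R`.
D-≥ : ∀ n → (fromℕ n + fromℕ 2) * fromℕ (4 ℕ.^ suc n) ≤ fromℕ 2 * fromℕ (D (suc n))
D-≥ zero    = ℚ.≤-refl
D-≥ (suc n) = *-cancelˡ-≤ (suc n) (subst
  (λ z → z * ((fromℕ (suc n) + fromℕ 2) * fromℕ (4 ℕ.^ suc (suc n))) ≤ z * (fromℕ 2 * b)) (sym (fromℕ-suc² n)) (begin
  (y + fromℕ 2) * ((fromℕ (suc n) + fromℕ 2) * fromℕ (4 ℕ.^ suc (suc n)))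
    ≡⟨ cong₂ (λ z f → (y + fromℕ 2) * ((z + fromℕ 2) * f)) (fromℕ-suc n) (fromℕ-^ 4 (suc n)) ⟩
  (y + fromℕ 2) * ((y + 1ℚ + fromℕ 2) * (fromℕ 4 * f))
    ≡⟨ solve 2 (λ y f → (y :+ c 2) :* ((y :+ c 1 :+ c 2) :* (c 4 :* f)) := c 4 :* (y :+ c 3) :* ((y :+ c 2) :* f)) refl y f ⟩
  fromℕ 4 * (y + fromℕ 3) * ((y + fromℕ 2) * f)
    ≤⟨ *-monoˡ (0≤fromℕ 4 ⊗ (0≤fromℕ n ⊕ 0≤fromℕ 3)) (D-≥ n) ⟩
  fromℕ 4 * (y + fromℕ 3) * (fromℕ 2 * a)
    ≡⟨ solve 2 (λ s a → c 4 :* s :* (c 2 :* a) := c 2 :* (c 4 :* s :* a)) refl (y + fromℕ 3) a ⟩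
  fromℕ 2 * (fromℕ 4 * (y + fromℕ 3) * a)
    ≤⟨ *-monoˡ (0≤fromℕ 2) (D-suc-≥ n) ⟩
  fromℕ 2 * ((y + fromℕ 2) * b)
    ≡⟨ solve 2 (λ s b → c 2 :* (s :* b) := s :* (c 2 :* b)) refl (y + fromℕ 2) b ⟩
  (y + fromℕ 2) * (fromℕ 2 * b) ∎))
  where
  open ℚ.≤-Reasoning
  y = fromℕ n
  f = fromℕ (4 ℕ.^ suc n)
  a = fromℕ (D (suc n))
  b = fromℕ (D (suc (suc n)))

-- The value ζ(3)

fromℕ-1/ : ∀ k .{{_ : NonZero k}} → fromℕ k * (+ 1 / k) ≡ 1ℚ
fromℕ-1/ (suc k) = fromℕ-inv k

fromℕ-cube : ∀ n → fromℕ (n ℕ.^ 3) ≡ fromℕ n ³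
fromℕ-cube n = trans (fromℕ-^ n 2) (trans (cong (fromℕ n *_) (trans (fromℕ-^ n 1) (cong (fromℕ n *_) (fromℕ-^ n 0))))
  (solve 1 (λ x → x :* (x :* (x :* c 1)) := x :³) refl (fromℕ n)))

Z : ℕ → ℚ
Z = zetaPartial 3

Z-suc : ∀ n → Z (suc n) ≡ Z n + inv n ³
Z-suc n = cong (_+_ (Z n)) (begin
  t
    ≡⟨ ℚ.*-identityʳ t ⟨
  t * 1ℚ
    ≡⟨ cong (λ z → t * z ³) (fromℕ-inv n) ⟨
  t * (s * inv n) ³
    ≡⟨ solve 3 (λ t s i → t :* (s :* i) :³ := s :³ :* t :* i :³) refl t s (inv n) ⟩
  s ³ * t * inv n ³
    ≡⟨ cong (λ z → z * t * inv n ³) (fromℕ-cube (suc n)) ⟨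
  fromℕ (suc n ℕ.^ 3) * t * inv n ³
    ≡⟨ cong (_* inv n ³) (fromℕ-1/ (suc n ℕ.^ 3) {{ℕ.m^n≢0 (suc n) 3}}) ⟩
  1ℚ * inv n ³
    ≡⟨ ℚ.*-identityˡ (inv n ³) ⟩
  inv n ³ ∎)
  where
  open ≡-Reasoning
  t = (+ 1 / (suc n ℕ.^ 3)) {{ℕ.m^n≢0 (suc n) 3}}
  s = fromℕ (suc n)

-- The left side is 8 times the sum of the odd terms among the first 2N terms of ζ(3); the even ones
-- add up to `Z N` / 8.
R₀-Z : ∀ N → fromℕ 24 * R 0 N ≡ fromℕ 8 * Z (2 ℕ.* N) - Z N
R₀-Z zero    = refl
R₀-Z (suc N) = begin
  fromℕ 24 * (R 0 N + inv 2 * o ³)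
    ≡⟨ solve 3 (λ r t o → c 24 :* (r :+ t :* o) := c 24 :* r :+ c 24 :* t :* o) refl (R 0 N) (inv 2) (o ³) ⟩
  fromℕ 24 * R 0 N + fromℕ 8 * o ³
    ≡⟨ cong (_+ fromℕ 8 * o ³) (R₀-Z N) ⟩
  (fromℕ 8 * Z (2 ℕ.* N) - Z N) + fromℕ 8 * o ³
    -- The even term missing from `Z` at 2N + 2 is added and subtracted.
    ≡⟨ solve 4 (λ z₂ z o e → (c 8 :* z₂ :- z) :+ c 8 :* o := c 8 :* (z₂ :+ o :+ e) :- (z :+ c 8 :* e))
         refl (Z (2 ℕ.* N)) (Z N) (o ³) (e ³) ⟩
  fromℕ 8 * (Z (2 ℕ.* N) + o ³ + e ³) - (Z N + fromℕ 8 * e ³)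
    ≡⟨ cong₂ (λ a b → fromℕ 8 * a - (Z N + b)) (sym even) half ⟩
  fromℕ 8 * Z (2 ℕ.* suc N) - (Z N + inv N ³)
    ≡⟨ cong (λ z → fromℕ 8 * Z (2 ℕ.* suc N) - z) (Z-suc N) ⟨
  fromℕ 8 * Z (2 ℕ.* suc N) - Z (suc N) ∎
  where
  open ≡-Reasoning
  o = inv (2 ℕ.* N)
  e = inv (suc (2 ℕ.* N))
  double : 2 ℕ.* suc N ≡ suc (suc (2 ℕ.* N))
  double = ℕ.*-suc 2 N
  even : Z (2 ℕ.* suc N) ≡ Z (2 ℕ.* N) + o ³ + e ³
  even = trans (cong Z double) (trans (Z-suc (suc (2 ℕ.* N))) (cong (_+ e ³) (Z-suc (2 ℕ.* N))))
  2e : fromℕ 2 * e ≡ inv N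
  2e = *-cancelˡ-≡ N (begin
    fromℕ (suc N) * (fromℕ 2 * e)
      ≡⟨ solve 2 (λ s e → s :* (c 2 :* e) := c 2 :* s :* e) refl (fromℕ (suc N)) e ⟩
    fromℕ 2 * fromℕ (suc N) * e
      ≡⟨ cong (_* e) (trans (sym (fromℕ-* 2 (suc N))) (cong fromℕ double)) ⟩
    fromℕ (suc (suc (2 ℕ.* N))) * e
      ≡⟨ fromℕ-inv (suc (2 ℕ.* N)) ⟩
    1ℚ
      ≡⟨ fromℕ-inv N ⟨
    fromℕ (suc N) * inv N ∎)
  half : fromℕ 8 * e ³ ≡ inv N ³
  half = trans (solve 1 (λ e → c 8 :* e :³ := (c 2 :* e) :³) refl e) (cong _³ 2e)

-- The limit

archimedean : ∀ p → ∃[ N ] p ≤ fromℕ N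
archimedean p@(mkℚ (+ n) d-1 _) = n , ℚ.toℚᵘ-cancel-≤ (ℚᵘ.≤-trans
  (ℚᵘ.*≤* (subst₂ ℤ._≤_ (ℤ.pos-* n 1) (ℤ.pos-* n (suc d-1)) (ℤ.+≤+ (ℕ.*-monoʳ-≤ n (ℕ.s≤s ℕ.z≤n)))))
  (ℚᵘ.≤-reflexive (ℚᵘ.≃-sym (toℚᵘ-/1 (+ n)))))
archimedean (mkℚ -[1+ n ] d-1 _) = 0 , *≤* ℤ.-≤+

archimedean-* : ∀ A ε → 0ℚ < ε → ∃[ N ] (∀ n → N ℕ.≤ n → A ≤ ε * fromℕ n)
archimedean-* A ε ε>0 = let N , h = archimedean (1/ ε * A) in N , λ n N≤n → begin
  A                      ≡⟨ ℚ.*-identityˡ A ⟨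
  1ℚ * A                 ≡⟨ cong (_* A) (ℚ.*-inverseʳ ε) ⟨
  ε * 1/ ε * A           ≡⟨ ℚ.*-assoc ε (1/ ε) A ⟩
  ε * (1/ ε * A)         ≤⟨ *-monoˡ (ℚ.<⇒≤ ε>0) (ℚ.≤-trans h (fromℕ-mono N≤n)) ⟩
  ε * fromℕ n            ∎
  where
  open ℚ.≤-Reasoning
  instance
    ε≢0 = ℚ.pos⇒nonZero ε {{positive ε>0}}

Null⇒small : ∀ {a} → Null a → ∀ ε → 0ℚ < ε → ∃[ N ] (∀ n → N ℕ.≤ n → ∣ a n ∣ ≤ ε)
Null⇒small (A , h) ε ε>0 = let N , A≤ = archimedean-* A ε ε>0 in N , λ n N≤n →
  *-cancelˡ-≤ n (ℚ.≤-trans (h n)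
    (subst (A ≤_) (ℚ.*-comm ε (fromℕ (suc n))) (A≤ (suc n) (ℕ.m≤n⇒m≤1+n N≤n))))

fromℕ-[n+1]³ : ∀ n → fromℕ ((suc n ℕ.+ 1) ℕ.^ 3) ≡ fromℕ (suc (suc n)) ³
fromℕ-[n+1]³ n = trans (cong (λ k → fromℕ (k ℕ.^ 3)) (ℕ.+-comm (suc n) 1)) (fromℕ-cube (suc (suc n)))

fromℕ-P : ∀ n → fromℕ (2 ℕ.* (2 ℕ.* n ℕ.+ 1) ℕ.* (5 ℕ.* n ℕ.^ 2 ℕ.+ 5 ℕ.* n ℕ.+ 2)) ≡ P (fromℕ n)
fromℕ-P n = trans (fromℕ-* (2 ℕ.* (2 ℕ.* n ℕ.+ 1)) (5 ℕ.* n ℕ.^ 2 ℕ.+ 5 ℕ.* n ℕ.+ 2)) (cong₂ _*_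
  (trans (fromℕ-* 2 (2 ℕ.* n ℕ.+ 1)) (cong (fromℕ 2 *_) (trans (fromℕ-+ (2 ℕ.* n) 1) (cong (_+ 1ℚ) (fromℕ-* 2 n)))))
  (trans (fromℕ-+ (5 ℕ.* n ℕ.^ 2 ℕ.+ 5 ℕ.* n) 2) (cong (_+ fromℕ 2) (trans (fromℕ-+ (5 ℕ.* n ℕ.^ 2) (5 ℕ.* n))
    (cong₂ _+_
      (trans (fromℕ-* 5 (n ℕ.^ 2)) (cong (fromℕ 5 *_)
        (trans (fromℕ-* n (n ℕ.* 1)) (cong (λ k → fromℕ n * fromℕ k) (ℕ.*-identityʳ n)))))
      (fromℕ-* 5 n))))))

fromℕ-64 : ∀ n → fromℕ (64 ℕ.* n ℕ.^ 3) ≡ fromℕ 64 * fromℕ n ³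
fromℕ-64 n = trans (fromℕ-* 64 (n ℕ.^ 3)) (cong (fromℕ 64 *_) (fromℕ-cube n))

-- Comparison with the partial sum of the same index k leaves a difference of two partial sums of
-- ζ(3), so the Cauchy property alone gives the limit.
R₀-tail : ∀ k → R 0 k - + 7 / 24 * Z k ≡ inv 2 * (Z (2 ℕ.* k) - Z k)
R₀-tail k = *-cancelˡ-≡ 23 (begin
  fromℕ 24 * (R 0 k - + 7 / 24 * Z k)
    ≡⟨ solve 3 (λ r t z → c 24 :* (r :- t :* z) := c 24 :* r :- c 24 :* t :* z) refl (R 0 k) (+ 7 / 24) (Z k) ⟩
  fromℕ 24 * R 0 k - fromℕ 7 * Z k
    ≡⟨ cong (_- fromℕ 7 * Z k) (R₀-Z k) ⟩
  (fromℕ 8 * Z (2 ℕ.* k) - Z k) - fromℕ 7 * Z k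
    ≡⟨ solve 2 (λ z₂ z → (c 8 :* z₂ :- z) :- c 7 :* z := c 8 :* (z₂ :- z)) refl (Z (2 ℕ.* k)) (Z k) ⟩
  fromℕ 24 * inv 2 * (Z (2 ℕ.* k) - Z k)
    ≡⟨ ℚ.*-assoc (fromℕ 24) (inv 2) (Z (2 ℕ.* k) - Z k) ⟩
  fromℕ 24 * (inv 2 * (Z (2 ℕ.* k) - Z k)) ∎)
  where open ≡-Reasoning

∣inv2*z∣≤∣z∣ : ∀ z → ∣ inv 2 * z ∣ ≤ ∣ z ∣
∣inv2*z∣≤∣z∣ z = subst (_≤ ∣ z ∣) (sym (ℚ.∣p*q∣≡∣p∣*∣q∣ (inv 2) z)) (≤-excess (0≤inv 2 ⊗ 0≤fromℕ 2 ⊗ ℚ.0≤∣p∣ z)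
  (trans (solve 2 (λ i z → i :* z :+ i :* c 2 :* z := i :* c 3 :* z) refl (inv 2) ∣ z ∣) (ℚ.*-identityˡ ∣ z ∣)))

R₀-limit : ∀ θ → 0ℚ < θ → ∃[ M ] (∀ k → M ℕ.≤ k → ∣ R 0 k - + 7 / 24 * Z k ∣ ≤ θ)
R₀-limit θ θ>0 = let M , h = cauchy (ζ 3) θ θ>0 in M , λ k M≤k →
  subst (λ z → ∣ z ∣ ≤ θ) (sym (R₀-tail k)) (ℚ.≤-trans (∣inv2*z∣≤∣z∣ (Z (2 ℕ.* k) - Z k))
    (ℚ.<⇒≤ (h (2 ℕ.* k) k (ℕ.≤-trans M≤k (ℕ.m≤m+n k (k ℕ.+ 0))) M≤k)))

-- With n = m + 1, `R n k` ≤ 4ⁿ while `D n` ≥ (n + 1) 4ⁿ / 2. The bound is uniform in k, so n can be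
-- chosen before k.
R-small : ∀ m θ → 0ℚ ≤ θ → fromℕ 2 ≤ θ * fromℕ m → ∀ k → R (suc m) k ≤ fromℕ (D (suc m)) * θ
R-small m θ θ≥0 2≤ k = *-cancelˡ-≤ 1 (begin
  fromℕ 2 * R (suc m) k
    ≤⟨ *-monoˡ (0≤fromℕ 2) (ℚ.≤-trans (R-≤ (suc m) k)
         (*-monoˡ (0≤fromℕ (4 ℕ.^ suc m)) (ℚ.≤-trans (≤-excess (0≤inv k) refl) (R₀-≤ k)))) ⟩
  fromℕ 2 * (fromℕ (4 ℕ.^ suc m) * 1ℚ)
    ≡⟨ solve 1 (λ f → c 2 :* (f :* c 1) := f :* c 2) refl (fromℕ (4 ℕ.^ suc m)) ⟩
  fromℕ (4 ℕ.^ suc m) * fromℕ 2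
    ≤⟨ *-monoˡ (0≤fromℕ (4 ℕ.^ suc m)) (ℚ.≤-trans 2≤ (*-monoˡ θ≥0 (≤-excess {fromℕ m} (0≤fromℕ 2) refl))) ⟩
  fromℕ (4 ℕ.^ suc m) * (θ * (fromℕ m + fromℕ 2))
    ≡⟨ solve 3 (λ f t s → f :* (t :* s) := t :* (s :* f)) refl (fromℕ (4 ℕ.^ suc m)) θ (fromℕ m + fromℕ 2) ⟩
  θ * ((fromℕ m + fromℕ 2) * fromℕ (4 ℕ.^ suc m))
    ≤⟨ *-monoˡ θ≥0 (D-≥ m) ⟩
  θ * (fromℕ 2 * fromℕ (D (suc m)))
    ≡⟨ solve 2 (λ t d → t :* (c 2 :* d) := c 2 :* (d :* t)) refl θ (fromℕ (D (suc m))) ⟩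
  fromℕ 2 * (fromℕ (D (suc m)) * θ) ∎)
  where open ℚ.≤-Reasoning

-- d (b/d - z) = (r - r₀ d + b) - r + d (r₀ - z), and each of the three parts is at most d θ in
-- absolute value; for the first this uses 1 ≤ d.
quotient-close : ∀ d .{{_ : ℚ.NonZero d}} b r r₀ z θ → 1ℚ ≤ d → 0ℚ ≤ θ → 0ℚ ≤ r → r ≤ d * θ →
  ∣ r - r₀ * d + b ∣ ≤ θ → ∣ r₀ - z ∣ ≤ θ → ∣ b ÷ d - z ∣ ≤ θ + θ + θ
quotient-close d b r r₀ z θ 1≤d θ≥0 r≥0 r≤ δ≤ z-close = ℚ.*-cancelˡ-≤-pos d {{positive d>0}} (begin
  d * ∣ b * 1/ d - z ∣
    ≡⟨ scale (b * 1/ d - z) ⟩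
  ∣ d * (b * 1/ d - z) ∣
    ≡⟨ cong ∣_∣ (solve 4 (λ d b i z → d :* (b :* i :- z) := b :* (d :* i) :- d :* z) refl d b (1/ d) z) ⟩
  ∣ b * (d * 1/ d) - d * z ∣
    ≡⟨ cong (λ u → ∣ b * u - d * z ∣) (ℚ.*-inverseʳ d) ⟩
  ∣ b * 1ℚ - d * z ∣
    ≡⟨ cong ∣_∣ (solve 5 (λ b d z r r₀ → b :* c 1 :- d :* z := ((r :- r₀ :* d :+ b) :- r) :+ d :* (r₀ :- z))
         refl b d z r r₀) ⟩
  ∣ ((r - r₀ * d + b) - r) + d * (r₀ - z) ∣
    ≤⟨ ℚ.≤-trans (ℚ.∣p+q∣≤∣p∣+∣q∣ ((r - r₀ * d + b) - r) (d * (r₀ - z)))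
         (ℚ.+-monoˡ-≤ ∣ d * (r₀ - z) ∣ (ℚ.∣p-q∣≤∣p∣+∣q∣ (r - r₀ * d + b) r)) ⟩
  ∣ r - r₀ * d + b ∣ + ∣ r ∣ + ∣ d * (r₀ - z) ∣
    ≡⟨ cong₂ (λ u v → ∣ r - r₀ * d + b ∣ + u + v) (ℚ.0≤p⇒∣p∣≡p r≥0) (sym (scale (r₀ - z))) ⟩
  ∣ r - r₀ * d + b ∣ + r + d * ∣ r₀ - z ∣
    ≤⟨ ℚ.+-mono-≤ (ℚ.+-mono-≤ (ℚ.≤-trans δ≤ θ≤dθ) r≤) (*-monoˡ d≥0 z-close) ⟩
  d * θ + d * θ + d * θ
    ≡⟨ solve 2 (λ d t → d :* t :+ d :* t :+ d :* t := d :* (t :+ t :+ t)) refl d θ ⟩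
  d * (θ + θ + θ) ∎)
  where
  open ℚ.≤-Reasoning
  d>0 : 0ℚ < d
  d>0 = ℚ.<-≤-trans (0<fromℕ-suc 0) 1≤d
  d≥0 : 0ℚ ≤ d
  d≥0 = ℚ.<⇒≤ d>0
  θ≤dθ : θ ≤ d * θ
  θ≤dθ = subst₂ _≤_ (ℚ.*-identityʳ θ) (ℚ.*-comm θ d) (*-monoˡ θ≥0 1≤d)
  scale : ∀ x → d * ∣ x ∣ ≡ ∣ d * x ∣
  scale x = trans (cong (_* ∣ x ∣) (sym (ℚ.0≤p⇒∣p∣≡p d≥0))) (sym (ℚ.∣p*q∣≡∣p∣*∣q∣ d x))

-- Three errors of δ/6 use up half of δ; the other half is the gap that `_<ℝ_` demands.
sixths : ∀ δ → + 1 / 6 * δ + + 1 / 6 * δ + + 1 / 6 * δ + ½ * δ ≡ 0ℚ + δ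
sixths δ = trans (solve 3 (λ s h d → s :* d :+ s :* d :+ s :* d :+ h :* d := (c 3 :* s :+ h) :* d) refl (+ 1 / 6) ½ δ)
  (solve 1 (λ d → c 1 :* d := c 0 :+ d) refl δ)

-- Comparison of `B` with the half-integer sums

module _ (B : ℕ → ℚ) (B₀ : B 0 ≡ 0ℚ) (B₁ : B 1 ≡ 1ℚ)
  (B-recurrence : ∀ n → fromℕ (suc (suc n)) ³ * B (suc (suc n))
    ≡ P (fromℕ (suc n)) * B (suc n) - fromℕ 64 * fromℕ (suc n) ³ * B n) where

  -- The defect at finite N of the limiting identity 7/24 ζ(3) `D n` - `B n` = the full half-integer
  -- sum.
  Δ : ℕ → ℕ → ℚ
  Δ n N = R n N - R 0 N * fromℕ (D n) + B n

  Δ₀ : ∀ N → 0ℚ ≡ Δ 0 N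
  Δ₀ N = trans (solve 1 (λ r → c 0 := r :- r :* c 1 :+ c 0) refl (R 0 N)) (cong (_+_ (R 0 N - R 0 N * 1ℚ)) (sym B₀))

  Δ₁ : ∀ N → (fromℕ 2 * fromℕ N + fromℕ 3) * T 0 N ≡ Δ 1 N
  Δ₁ N = begin
    b
      ≡⟨ solve 2 (λ b r → b := (c 4 :* r :+ b) :- r :* c 4) refl b (R 0 N) ⟩
    (fromℕ 4 * R 0 N + b) - R 0 N * fromℕ 4
      ≡⟨ cong (_- R 0 N * fromℕ 4) (R-one N) ⟨
    (R 1 N + 1ℚ) - R 0 N * fromℕ 4
      ≡⟨ solve 2 (λ r₁ r → (r₁ :+ c 1) :- r := r₁ :- r :+ c 1) refl (R 1 N) (R 0 N * fromℕ 4) ⟩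
    R 1 N - R 0 N * fromℕ 4 + 1ℚ
      ≡⟨ cong (_+_ (R 1 N - R 0 N * fromℕ 4)) B₁ ⟨
    Δ 1 N ∎
    where
    open ≡-Reasoning
    b = (fromℕ 2 * fromℕ N + fromℕ 3) * T 0 N

  -- `R`, `D` and `B` obey one linear recurrence, with `U` as the only inhomogeneity. The cube is
  -- split into three factors so that `Null-cancel` can remove them in turn.
  Δ-recurrence : ∀ n N → P (fromℕ (suc n)) * Δ (suc n) N + (- (fromℕ 64 * fromℕ (suc n) ³) * Δ n N + U n N)
    ≡ fromℕ (suc (suc n)) * (fromℕ (suc (suc n)) * (fromℕ (suc (suc n)) * Δ (suc (suc n)) N))
  Δ-recurrence n N = begin
    p * (R (suc n) N - r * D₁ + B (suc n)) + (- k * (R n N - r * D₀ + B n) + U n N)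
      ≡⟨ cong₂ (λ a b → a + (b + U n N)) (expand p (R (suc n) N) (r * D₁) (B (suc n)))
           (expand (- k) (R n N) (r * D₀) (B n)) ⟩
    (p * R (suc n) N - p * (r * D₁) + p * B (suc n)) + ((- k * R n N - - k * (r * D₀) + - k * B n) + U n N)
      ≡⟨ trans (cong (λ z → (p * R (suc n) N - p * (r * D₁) + p * B (suc n)) + (z + U n N))
             (negate (R n N) (r * D₀) (B n)))
           (solve 7 (λ x y z x′ y′ z′ u → (x :- y :+ z) :+ ((:- (x′ :- y′ :+ z′)) :+ u)
               := (x :- x′ :+ u) :- (y :- y′) :+ (z :- z′)) refl
             (p * R (suc n) N) (p * (r * D₁)) (p * B (suc n)) (k * R n N) (k * (r * D₀)) (k * B n) (U n N)) ⟩
    (p * R (suc n) N - k * R n N + U n N) - (p * (r * D₁) - k * (r * D₀)) + (p * B (suc n) - k * B n)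
      ≡⟨ cong (λ z → (p * R (suc n) N - k * R n N + U n N) - z + (p * B (suc n) - k * B n))
           (solve 5 (λ p k r d₁ d₀ → p :* (r :* d₁) :- k :* (r :* d₀) := r :* (p :* d₁ :- k :* d₀)) refl p k r D₁ D₀) ⟩
    (p * R (suc n) N - k * R n N + U n N) - r * (p * D₁ - k * D₀) + (p * B (suc n) - k * B n)
      ≡⟨ cong₂ _+_ (cong₂ (λ a b → a - r * b) (R-recurrence n N) (D-recurrence n)) (B-recurrence n) ⟨
    s ³ * R (suc (suc n)) N - r * (s ³ * fromℕ (D (suc (suc n)))) + s ³ * B (suc (suc n))
      ≡⟨ solve 5 (λ s r₂ r d₂ b₂ → s :³ :* r₂ :- r :* (s :³ :* d₂) :+ s :³ :* b₂
           := s :* (s :* (s :* (r₂ :- r :* d₂ :+ b₂)))) refl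
           s (R (suc (suc n)) N) r (fromℕ (D (suc (suc n)))) (B (suc (suc n))) ⟩
    s * (s * (s * Δ (suc (suc n)) N)) ∎
    where
    open ≡-Reasoning
    s = fromℕ (suc (suc n))
    p = P (fromℕ (suc n))
    k = fromℕ 64 * fromℕ (suc n) ³
    r = R 0 N
    D₁ = fromℕ (D (suc n))
    D₀ = fromℕ (D n)
    negate : ∀ x y z → - k * x - - k * y + - k * z ≡ - (k * x - k * y + k * z)
    negate = solve 4 (λ k x y z → (:- k) :* x :- (:- k) :* y :+ (:- k) :* z := :- (k :* x :- k :* y :+ k :* z)) refl k
    expand : ∀ a x y z → a * (x - y + z) ≡ a * x - a * y + a * z
    expand = solve 4 (λ a x y z → a :* (x :- y :+ z) := a :* x :- a :* y :+ a :* z) refl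

  -- A second-order recurrence calls for two consecutive values. At n = 0 the defect is zero, and at
  -- n = 1 the value `B 1` = 1 matches the constant in `R-one`.
  Null-Δ : ∀ n → Null (Δ n) × Null (Δ (suc n))
  Null-Δ zero    = Null-cong Δ₀ (0ℚ , λ N → ℚ.≤-reflexive (ℚ.*-zeroʳ (fromℕ (suc N)))) , Null-cong Δ₁ Null-boundary
  Null-Δ (suc n) = proj₂ (Null-Δ n) , Null-cancel (suc n) (Null-cancel (suc n) (Null-cancel (suc n)
    (Null-cong (Δ-recurrence n)
    (Null-+ (Null-* (P (fromℕ (suc n))) (proj₂ (Null-Δ n)))
      (Null-+ (Null-* (- (fromℕ 64 * fromℕ (suc n) ³)) (proj₁ (Null-Δ n))) (Null-U n))))))

  quotient : ℕ → ℚ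
  quotient n = (B n ÷ fromℕ (D n)) {{D≢0 n}}

  -- The threshold for n depends on θ alone, through `R-small`; the one for the approximation index
  -- k may depend on n, because the constants in `Null-Δ` do.
  quotient-limit : ∀ θ → 0ℚ < θ → ∃[ N ] (∀ n → N ℕ.≤ n → ∃[ M ] (∀ k → M ℕ.≤ k →
    ∣ quotient n - + 7 / 24 * Z k ∣ ≤ θ + θ + θ))
  quotient-limit θ θ>0 = let N , 2≤ = archimedean-* (fromℕ 2) θ θ>0 in suc N , λ where
    (suc m) (ℕ.s≤s N≤m) →
      let M₁ , R₀-close = R₀-limit θ θ>0
          M₂ , Δ-small = Null⇒small (proj₁ (Null-Δ (suc m))) θ θ>0
      in M₁ ℕ.⊔ M₂ , λ k k≥ →
        quotient-close (fromℕ (D (suc m))) {{D≢0 (suc m)}} (B (suc m)) (R (suc m) k) (R 0 k) (+ 7 / 24 * Z k) θ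
          (fromℕ-mono (D>0 (suc m))) (ℚ.<⇒≤ θ>0) (0≤R (suc m) k) (R-small m θ (ℚ.<⇒≤ θ>0) (2≤ m N≤m) k)
          (Δ-small k (ℕ.m⊔n≤o⇒n≤o M₁ M₂ k≥)) (R₀-close k (ℕ.m⊔n≤o⇒m≤o M₁ M₂ k≥))

  limit : (λ n → fromℚ (quotient n)) ⟶ (fromℚ (+ 7 / 24) *ℝ ζ 3)
  limit ε (δ , δ>0 , M₀ , δ<ε) =
    let N , h = quotient-limit (+ 1 / 6 * δ) (ℚ.*-monoʳ-<-pos (+ 1 / 6) δ>0) in
    N , λ n N≤n → let M , h′ = h n N≤n in
    -- From M₀ on ε exceeds δ, and the distance is at most δ/2, so δ/2 serves as the gap.
    ½ * δ , ℚ.*-monoʳ-<-pos ½ δ>0 , M ℕ.⊔ M₀ , λ k k≥ →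
      ℚ.≤-<-trans (ℚ.+-monoˡ-≤ (½ * δ) (h′ k (ℕ.m⊔n≤o⇒m≤o M M₀ k≥)))
        (subst (_< seq ε k) (sym (sixths δ)) (δ<ε k (ℕ.m⊔n≤o⇒n≤o M M₀ k≥)))

theorem1p1 : (B : ℕ → ℚ) →
    B 0 ≡ 0ℚ →
    B 1 ≡ 1ℚ →
    (∀ n → 1 ℕ.≤ n →
    fromℕ ((n ℕ.+ 1) ℕ.^ 3) ℚ.* B (n ℕ.+ 1)
    ≡ fromℕ (2 ℕ.* (2 ℕ.* n ℕ.+ 1) ℕ.* (5 ℕ.* n ℕ.^ 2 ℕ.+ 5 ℕ.* n ℕ.+ 2)) ℚ.* B n
    ℚ.- fromℕ (64 ℕ.* n ℕ.^ 3) ℚ.* B (n ℕ.∸ 1)) →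
    (λ n → fromℚ ((B n ℚ.÷ fromℕ (D n)) {{D≢0 n}})) ⟶ (fromℚ (+ 7 / 24) *ℝ ζ 3)
theorem1p1 B B₀ B₁ rec = limit B B₀ B₁ λ n → trans
  (sym (cong₂ _*_ (fromℕ-[n+1]³ n) (cong B (ℕ.+-comm (suc n) 1))))
  (trans (rec (suc n) (ℕ.s≤s ℕ.z≤n)) (cong₂ (λ p k → p * B (suc n) - k * B n) (fromℕ-P (suc n)) (fromℕ-64 (suc n))))
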